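{- Let $n\ge 2$ and let $c=p^a$ ($p$ an odd prime, $a\ge1$) be a prime power with $c\equiv1\pmod{2n}$ and $c+n=\binom{k}{2}$ for some integer $k\ge 2n$; let $d=1+(c-1)/n$. Let $\mathbb{F}$ be the field of order $c$ with primitive element $\zeta$, $H=N\rtimes\langle\zeta^n\rangle\le\mathrm{AGL}(1,c)$ with $N$ the translation group, $R=\mathbb{Z}_d=\{0,1,\dots,d-1\}$, $K=\mathrm{Sym}(d)$ on $R$, and $G=H\wr K$ acting on $\mathscr{P}=\mathbb{F}\times R$ by $(x,j)^{(h_1,\dots,h_d)\sigma}=(x^{h_j},j^\sigma)$; let $\mathscr{C}=\{C_j:j\in R\}$ with $C_j=\mathbb{F}\times\{j\}$. Let \[B=\{(0,i),(\zeta^i,i):0\le i\le n-1\}\cup\{(0,i):n\le i\le k-n-1\}\] (a $k$-subset of $\mathscr{P}$) and $\mathscr{B}=B^G$. Then $\mathscr{D}=(\mathscr{P},\mathscr{B})$ is a $2$-$(cd,k,\lambda)$ design for some $\lambda$, and $G$ is a block-transitive, point-imprimitive group of automorphisms of $\mathscr{D}$ leaving $\mathscr{C}$ invariant. Moreover: (a) the Delandtsheer--Doyen parameters of $\mathscr{D}$ relative to $G$ and $\mathscr{C}$ are $(m,n)=(1,n)$; (b) $\mathrm{Rank}(H)=\mathrm{PairRank}(H)+1=n+1$ and $\mathrm{Rank}(K)=\mathrm{PairRank}(K)+1=2$.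
   Context: A $2$-$(v,k,\lambda)$ design has $v$ points, blocks which are $k$-subsets, every pair of distinct points in exactly $\lambda$ blocks. For a block-transitive group preserving a partition into $d$ classes of size $c$, inner pairs are unordered pairs of distinct points in the same class and outer pairs those in different classes; by Delandtsheer--Doyen there are positive integers $m,n$ with $c=(\binom{k}{2}-n)/m$, $d=(\binom{k}{2}-m)/n$, where $n$ is the number of inner pairs in a block and $mc$ the number of outer pairs in a block (the Delandtsheer--Doyen parameters). $\mathrm{Rank}(X)$ is the number of $X$-orbits on $\Omega\times\Omega$ and $\mathrm{PairRank}(X)$ the number of $X$-orbits on unordered pairs of distinct points. -}

module Defs where

open import Level using (Level; 0ℓ; _⊔_; suc)
open import Algebra.Bundles using (CommutativeRing)
open import Data.Nat using (ℕ; zero; suc; _≤_; _<_; _∸_; _+_; _*_)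
open import Data.Nat.Combinatorics using (_C_)
open import Data.Fin using (Fin; toℕ)
open import Data.Fin.Permutation using (Permutation′; _⟨$⟩ʳ_)
open import Data.Product using (Σ; _×_; _,_)
open import Data.Sum using (_⊎_)
open import Data.Unit using (⊤)
open import Data.List using (List; length)
open import Data.List.Relation.Unary.All using (All)
open import Data.List.Relation.Unary.Any using (Any)
open import Data.List.Relation.Unary.AllPairs using (AllPairs)
open import Relation.Nullary using (¬_)
open import Relation.Binary.PropositionalEquality using (_≡_)

HasSize : ∀ {a ℓ p} {A : Set a} (_~_ : A → A → Set ℓ) (P : A → Set p) → ℕ → Set (a ⊔ ℓ ⊔ p)
HasSize {A = A} _~_ P k =
  Σ (List A) λ L →
    AllPairs (λ x y → ¬ (x ~ y)) L × All P L ×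
    (∀ x → P x → Any (x ~_) L) × length L ≡ k

NumClasses : ∀ {a ℓ} {A : Set a} (_~_ : A → A → Set ℓ) → ℕ → Set (a ⊔ ℓ)
NumClasses _~_ r = HasSize _~_ (λ _ → ⊤) r

module FieldNotions (R : CommutativeRing 0ℓ 0ℓ) where
  open CommutativeRing R renaming (_+_ to _+F_; _*_ to _*F_)

  IsField : Set
  IsField = ¬ (1# ≈ 0#) × (∀ x → ¬ (x ≈ 0#) → Σ Carrier λ y → x *F y ≈ 1#)

  pow : Carrier → ℕ → Carrier
  pow x zero    = 1#
  pow x (suc i) = x *F pow x i

  HasOrder : ℕ → Set
  HasOrder c = HasSize _≈_ (λ _ → ⊤) c

  IsPrimitive : Carrier → Set
  IsPrimitive ζ = ∀ x → ¬ (x ≈ 0#) → Σ ℕ λ i → pow ζ i ≈ x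

open FieldNotions public

module Construction (R : CommutativeRing 0ℓ 0ℓ) (ζ : CommutativeRing.Carrier R)
                    (n c d k : ℕ) where
  open CommutativeRing R renaming (_+_ to _+F_; _*_ to _*F_)
  F = Carrier

  HElt : Set
  HElt = ℕ × F

  actH : HElt → F → F
  actH (t , b) x = (pow R ζ (n * t) *F x) +F b

  KElt : Set
  KElt = Permutation′ d

  Point : Set
  Point = F × Fin d

  _≈P_ : Point → Point → Set
  (x , j) ≈P (y , l) = (x ≈ y) × (j ≡ l)

  GElt : Set
  GElt = (Fin d → HElt) × KElt

  actG : GElt → Point → Point
  actG (hs , σ) (x , j) = (actH (hs j) x , σ ⟨$⟩ʳ j)

  PSet : Set₁
  PSet = Point → Set

  _≋_ : PSet → PSet → Set
  S ≋ T = ∀ p → (S p → T p) × (T p → S p)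

  image : GElt → PSet → PSet
  image g S p = Σ Point λ q → S q × (actG g q ≈P p)

  B : PSet
  B (x , j) = (toℕ j < n × ((x ≈ 0#) ⊎ (x ≈ pow R ζ (toℕ j))))
            ⊎ (n ≤ toℕ j × toℕ j < k ∸ n × x ≈ 0#)

  IsBlock : PSet → Set
  IsBlock S = Σ GElt λ g → S ≋ image g B

  Cls : Fin d → PSet
  Cls j (x , l) = l ≡ j

  _≈UP_ : Point × Point → Point × Point → Set
  (a , b) ≈UP (a' , b') = ((a ≈P a') × (b ≈P b')) ⊎ ((a ≈P b') × (b ≈P a'))

  SameClass : Point → Point → Set
  SameClass (x , j) (y , l) = j ≡ l

  Is2Design : Set₁
  Is2Design =
    HasSize _≈P_ (λ _ → ⊤) (c * d) ×
    (∀ S → IsBlock S → HasSize _≈P_ S k) ×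
    Σ ℕ λ λ′ → ∀ α β → ¬ (α ≈P β) →
      HasSize _≋_ (λ S → IsBlock S × S α × S β) λ′

  IsAutGroup : Set₁
  IsAutGroup =
    (∀ g p → Σ Point λ q → actG g q ≈P p) ×
    (∀ g p q → actG g p ≈P actG g q → p ≈P q) ×
    (∀ g S → IsBlock S → IsBlock (image g S))

  BlockTransitive : Set₁
  BlockTransitive = ∀ S T → IsBlock S → IsBlock T → Σ GElt λ g → image g S ≋ T

  PartitionInvariant : Set
  PartitionInvariant = ∀ g j → Σ (Fin d) λ j′ → image g (Cls j) ≋ Cls j′

  PointImprimitive : Set
  PointImprimitive =
    (∀ p q → Σ GElt λ g → actG g p ≈P q) × PartitionInvariant × (1 < c) × (1 < d)

  -- Delandtsheer–Doyen parameters (m , n′): every block contains n′ inner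
  -- pairs and m·c outer pairs, and c = (C(k,2) - n′)/m, d = (C(k,2) - m)/n′
  DDParams : ℕ → ℕ → Set₁
  DDParams m n′ =
    1 ≤ m × 1 ≤ n′ ×
    (m * c ≡ (k C 2) ∸ n′) × (n′ * d ≡ (k C 2) ∸ m) ×
    (∀ S → IsBlock S →
       HasSize _≈UP_ (λ { (a , b) → S a × S b × ¬ (a ≈P b) × SameClass a b }) n′ ×
       HasSize _≈UP_ (λ { (a , b) → S a × S b × ¬ (a ≈P b) × ¬ SameClass a b }) (m * c))

  RankRelH : F × F → F × F → Set
  RankRelH (x , y) (x′ , y′) = Σ HElt λ h → (actH h x ≈ x′) × (actH h y ≈ y′)

  PairRelH : F × F → F × F → Set
  PairRelH (x , y) (x′ , y′) = Σ HElt λ h →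
    ((actH h x ≈ x′) × (actH h y ≈ y′)) ⊎ ((actH h x ≈ y′) × (actH h y ≈ x′))

  RankH : ℕ → Set
  RankH r = NumClasses RankRelH r

  PairRankH : ℕ → Set
  PairRankH r = HasSize PairRelH (λ { (x , y) → ¬ (x ≈ y) }) r

  RankRelK : Fin d × Fin d → Fin d × Fin d → Set
  RankRelK (i , j) (i′ , j′) = Σ KElt λ σ → (σ ⟨$⟩ʳ i ≡ i′) × (σ ⟨$⟩ʳ j ≡ j′)

  PairRelK : Fin d × Fin d → Fin d × Fin d → Set
  PairRelK (i , j) (i′ , j′) = Σ KElt λ σ →
    ((σ ⟨$⟩ʳ i ≡ i′) × (σ ⟨$⟩ʳ j ≡ j′)) ⊎ ((σ ⟨$⟩ʳ i ≡ j′) × (σ ⟨$⟩ʳ j ≡ i′))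

  RankK : ℕ → Set
  RankK r = NumClasses RankRelK r

  PairRankK : ℕ → Set
  PairRankK r = HasSize PairRelK (λ { (i , j) → ¬ (i ≡ j) }) r

  Conclusion : Set₁
  Conclusion =
    Is2Design × IsAutGroup × BlockTransitive × PointImprimitive ×
    DDParams 1 n ×
    (RankH (n + 1) × PairRankH n) ×
    (RankK 2 × PairRankK 1)

open Construction public using (Conclusion)

{-# OPTIONS --safe #-}
module Submission where

-- For a G-orbit O of ordered pairs of distinct points, double counting the
-- incidences between blocks and pairs of O gives
--   (number of blocks) * |O ∩ B²| = |O| * (number of blocks through a pair of O),
-- so D is a 2-design as soon as |O ∩ B²| / |O| does not depend on O. The outer
-- pairs form one orbit of size cd * c(d-1), with C(k,2) - n = c unordered pairs in
-- B. The inner pairs split according to the coset of ⟨ζⁿ⟩ that contains the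
-- difference y - x: since -1 ∈ ⟨ζⁿ⟩ (as 2n divides c - 1) these are n orbits
-- closed under swapping, each of size cd * (d-1), and the pair {(0,i), (ζⁱ,i)}
-- is the only one in B with difference in ζⁱ⟨ζⁿ⟩. Both ratios equal 2 / (cd(d-1)).

open import Defs
open import Level using (Level; 0ℓ; _⊔_)
open import Algebra.Bundles using (CommutativeRing)
import Algebra.Properties.Ring as RingProperties
open import Data.Nat using (ℕ; zero; suc; _≤_; _<_; z≤n; s≤s; _+_; _*_; _∸_; _^_; NonZero; >-nonZero; nonTrivial⇒n>1)
import Data.Nat.Properties as ℕₚ
open import Data.Nat.DivMod using (_%_; _/_; m%n<n; m≡m%n+[m/n]*n; m<n⇒m%n≡m; m∣n⇒o%n%m≡o%m; [m+kn]%n≡m%n)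
open import Data.Nat.Divisibility using (_∣_; divides; m∣m*n)
open import Data.Nat.Primality using (Prime; prime⇒nonTrivial)
open import Data.Nat.Combinatorics using (_C_; nC1≡n; nCk+nC[k+1]≡[n+1]C[k+1])
open import Data.Nat.Solver using (module +-*-Solver)
open import Data.Fin as Fin using (Fin; zero; suc; toℕ)
import Data.Fin.Properties as Finₚ
open import Data.Fin.Permutation using (Permutation′; _⟨$⟩ʳ_; _⟨$⟩ˡ_; transpose; _∘ₚ_; permutation; flip)
import Data.Fin.Permutation as Perm
open import Data.List using (lookup; tabulate)
open import Data.List.Properties using (length-tabulate)
open import Data.List.Membership.Propositional.Properties using (∈-lookup)
import Data.List.Relation.Unary.All as All
import Data.List.Relation.Unary.All.Properties as Allₚ
import Data.List.Relation.Unary.Any as Any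
import Data.List.Relation.Unary.Any.Properties as Anyₚ
open import Data.List.Relation.Unary.AllPairs using (AllPairs; _∷_)
import Data.List.Relation.Unary.AllPairs.Properties as AllPairsₚ
open import Data.Product using (Σ; _×_; _,_; proj₁; proj₂; swap; uncurry)
open import Data.Product.Relation.Binary.Pointwise.NonDependent using (Pointwise; ×-isEquivalence)
open import Data.Sum using (_⊎_; inj₁; inj₂; [_,_]′)
open import Data.Unit using (⊤; tt)
open import Function using (_∘_; id)
open import Relation.Nullary using (¬_; Dec; yes; no; contradiction)
open import Relation.Nullary.Decidable using (_×-dec_; _⊎-dec_; _→-dec_; ¬?) renaming (map′ to mapDec)
open import Relation.Binary using (IsEquivalence; Symmetric; Transitive; tri<; tri≈; tri>)
open import Relation.Binary.PropositionalEquality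
  using (_≡_; _≢_; _≗_; refl; sym; trans; cong; cong₂; subst; subst₂; isEquivalence; module ≡-Reasoning)
import Relation.Binary.Reasoning.Setoid as SetoidReasoning

-- Finite enumerations

-- Sizes are witnessed by explicit finite lists, and blocks are predicates compared by `_≋_`, so the
-- number of blocks through a pair must be exhibited before it can enter an equation. Neither this
-- number nor the number of blocks is evaluated: finitely many group elements that realise every
-- action are sieved by decidable equality of the images of `B`, some length results, and the
-- counting equations are compared by cancellation.
--
-- The choice d - 1 = (c - 1)/n gives one number D two meanings: it is the order of ⟨ζⁿ⟩, hence the
-- number of second points of an inner orbit, and the number of classes other than a given one. This
-- is why an outer orbit is exactly c times as large as an inner one. It remains to see that `B`
-- fits into d classes; this is where c + n = C(k,2) and n ≥ 2 bound k - n.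

private variable
  a b p q ℓ ℓ′ : Level
  A : Set a
  k l : ℕ

-- HasSize with the list replaced by a family indexed by Fin k.
record Enum {A : Set a} (_~_ : A → A → Set ℓ) (P : A → Set p) (k : ℕ) : Set (a ⊔ ℓ ⊔ p) where
  field
    elt       : Fin k → A
    injective : ∀ {i j} → elt i ~ elt j → i ≡ j
    sound     : ∀ i → P (elt i)
    complete  : ∀ x → P x → Σ (Fin k) λ i → x ~ elt i

open Enum

enum⇒size : {_~_ : A → A → Set ℓ} {P : A → Set p} → Enum _~_ P k → HasSize _~_ P k
enum⇒size E =
  tabulate (elt E) ,
  AllPairsₚ.tabulate⁺ (λ i≢j eq → i≢j (injective E eq)) ,
  Allₚ.tabulate⁺ (sound E) ,
  (λ x px → let i , eq = complete E x px in Anyₚ.tabulate⁺ i eq) ,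
  length-tabulate (elt E)

lookup-injective : {_~_ : A → A → Set ℓ} → Symmetric _~_ → ∀ {xs} →
  AllPairs (λ x y → ¬ x ~ y) xs → ∀ {i j} → lookup xs i ~ lookup xs j → i ≡ j
lookup-injective sy (_ ∷ _)  {zero}  {zero}  _  = refl
lookup-injective sy (x≁ ∷ _) {zero}  {suc j} eq = contradiction eq (All.lookup x≁ (∈-lookup j))
lookup-injective sy (x≁ ∷ _) {suc i} {zero}  eq = contradiction (sy eq) (All.lookup x≁ (∈-lookup i))
lookup-injective sy (_ ∷ ap) {suc i} {suc j} eq = cong suc (lookup-injective sy ap eq)

size⇒enum : {_~_ : A → A → Set ℓ} {P : A → Set p} → Symmetric _~_ → HasSize _~_ P k → Enum _~_ P k
size⇒enum sy (xs , distinct , all , covers , refl) = record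
  { elt       = lookup xs
  ; injective = lookup-injective sy distinct
  ; sound     = λ i → All.lookup all (∈-lookup i)
  ; complete  = λ x px → Any.index (covers x px) , Anyₚ.lookup-index (covers x px)
  }

module _ {_~_ : A → A → Set ℓ} {P : A → Set p} where

  enum-⇔ : {Q : A → Set q} → (∀ x → P x → Q x) → (∀ x → Q x → P x) → Enum _~_ P k → Enum _~_ Q k
  enum-⇔ to from E = record
    { elt = elt E
    ; injective = injective E
    ; sound = λ i → to _ (sound E i)
    ; complete = λ x qx → complete E x (from x qx)
    }

  enum-map : {B : Set b} {_≈_ : B → B → Set ℓ′} {Q : B → Set q} → Transitive _≈_ → (f : A → B) →
    (∀ {x y} → x ~ y → f x ≈ f y) →
    (∀ {x y} → P x → P y → f x ≈ f y → x ~ y) →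
    (∀ x → P x → Q (f x)) →
    (∀ y → Q y → Σ A λ x → P x × y ≈ f x) →
    Enum _~_ P k → Enum _≈_ Q k
  enum-map tr f f-cong f-inj to from E = record
    { elt = f ∘ elt E
    ; injective = λ eq → injective E (f-inj (sound E _) (sound E _) eq)
    ; sound = λ i → to _ (sound E i)
    ; complete = λ y qy → let x , px , y≈fx = from y qy ; i , x~eᵢ = complete E x px
                          in i , tr y≈fx (f-cong x~eᵢ)
    }

  enum-≤ : {Q : A → Set q} → IsEquivalence _~_ → (∀ x → P x → Q x) →
    Enum _~_ P k → Enum _~_ Q l → k ≤ l
  enum-≤ eq P⊆Q E E′ = Finₚ.injective⇒≤ {f = proj₁ ∘ pos} λ {i} {j} fi≡fj → injective E
    (IsEquivalence.trans eq (proj₂ (pos i))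
      (IsEquivalence.sym eq (subst (λ h → elt E j ~ elt E′ h) (sym fi≡fj) (proj₂ (pos j)))))
    where
    pos : ∀ i → Σ _ λ j → elt E i ~ elt E′ j
    pos i = complete E′ (elt E i) (P⊆Q _ (sound E i))

  enum-singleton : ∀ x → P x → (∀ y → P y → y ~ x) → Enum _~_ P 1
  enum-singleton x px uniq = record
    { elt = λ _ → x
    ; injective = λ { {zero} {zero} _ → refl }
    ; sound = λ _ → px
    ; complete = λ y py → zero , uniq y py
    }

  enum-empty : (∀ x → ¬ P x) → Enum _~_ P 0
  enum-empty ∄ = record
    { elt = λ () ; injective = λ { {()} } ; sound = λ () ; complete = λ x px → contradiction px (∄ x) }

  enum-⊎ : {Q : A → Set q} → Symmetric _~_ → (∀ {x y} → P x → Q y → ¬ x ~ y) →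
    Enum _~_ P k → Enum _~_ Q l → Enum _~_ (λ x → P x ⊎ Q x) (k + l)
  enum-⊎ {k = k} {l} {Q} sy disjoint E E′ = record
    { elt = elt⊎ ∘ Fin.splitAt k
    ; injective = λ {i} {j} eq → trans (sym (Finₚ.join-splitAt k l i))
        (trans (cong (Fin.join k l) (inj⊎ (Fin.splitAt k i) (Fin.splitAt k j) eq)) (Finₚ.join-splitAt k l j))
    ; sound = sound⊎ ∘ Fin.splitAt k
    ; complete = complete⊎
    }
    where
    elt⊎ : Fin k ⊎ Fin l → A
    elt⊎ = [ elt E , elt E′ ]′
    inj⊎ : ∀ u v → elt⊎ u ~ elt⊎ v → u ≡ v
    inj⊎ (inj₁ i) (inj₁ j) eq = cong inj₁ (injective E eq)
    inj⊎ (inj₁ i) (inj₂ j) eq = contradiction eq (disjoint (sound E i) (sound E′ j))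
    inj⊎ (inj₂ i) (inj₁ j) eq = contradiction (sy eq) (disjoint (sound E j) (sound E′ i))
    inj⊎ (inj₂ i) (inj₂ j) eq = cong inj₂ (injective E′ eq)
    sound⊎ : ∀ u → P (elt⊎ u) ⊎ Q (elt⊎ u)
    sound⊎ (inj₁ i) = inj₁ (sound E i)
    sound⊎ (inj₂ i) = inj₂ (sound E′ i)
    complete⊎ : ∀ x → P x ⊎ Q x → Σ (Fin (k + l)) λ i → x ~ elt⊎ (Fin.splitAt k i)
    complete⊎ x (inj₁ px) = let i , eq = complete E x px in
      i Fin.↑ˡ l , subst (λ u → x ~ elt⊎ u) (sym (Finₚ.splitAt-↑ˡ k i l)) eq
    complete⊎ x (inj₂ qx) = let i , eq = complete E′ x qx in
      k Fin.↑ʳ i , subst (λ u → x ~ elt⊎ u) (sym (Finₚ.splitAt-↑ʳ k l i)) eq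

  enum-Σ : {B : Set b} {_≈_ : B → B → Set ℓ′} {I : A → B → Set q} → Symmetric _~_ →
    (∀ {x x′ y} → x ~ x′ → I x y → I x′ y) →
    Enum _~_ P k → (∀ x → P x → Enum _≈_ (I x) l) →
    Enum (Pointwise _~_ _≈_) (λ (x , y) → P x × I x y) (k * l)
  enum-Σ {k = k} {l} {B} {_≈_} sy I-resp E F = record
    { elt = pair ∘ Fin.remQuot {k} l
    ; injective = λ {i} {j} eq → trans (sym (Finₚ.combine-remQuot {k} l i))
        (trans (cong (uncurry Fin.combine) (pair-injective _ _ eq)) (Finₚ.combine-remQuot {k} l j))
    ; sound = λ i → let u , v = Fin.remQuot {k} l i in sound E u , sound (fibre u) v
    ; complete = λ (x , y) (px , ixy) →
        let u , x~ = complete E x px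
            v , y≈ = complete (fibre u) y (I-resp x~ ixy)
        in Fin.combine u v ,
           subst (λ w → Pointwise _~_ _≈_ (x , y) (pair w)) (sym (Finₚ.remQuot-combine u v)) (x~ , y≈)
    }
    where
    fibre : ∀ u → Enum _ _ l
    fibre u = F (elt E u) (sound E u)
    pair : Fin k × Fin l → A × B
    pair (u , v) = elt E u , elt (fibre u) v
    pair-injective : ∀ w w′ → Pointwise _~_ _≈_ (pair w) (pair w′) → w ≡ w′
    pair-injective (u , v) (u′ , v′) (eq , eq′) with refl ← injective E eq =
      cong (u ,_) (injective (fibre u) eq′)

enum-unique : {_~_ : A → A → Set ℓ} {P : A → Set p} {Q : A → Set q} → IsEquivalence _~_ →
  (∀ x → P x → Q x) → (∀ x → Q x → P x) → Enum _~_ P k → Enum _~_ Q l → k ≡ l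
enum-unique eq to from E E′ = ℕₚ.≤-antisym (enum-≤ eq to E E′) (enum-≤ eq from E′ E)

-- Both products count the incident pairs, fibred once over `P` and once over `Q`; uniqueness of
-- sizes identifies them after a swap. `respB` may assume `P x` because in the application `x` is a
-- predicate on points, and only blocks are known to respect equality of points.
double-count : {A : Set a} {B : Set b} {_~_ : A → A → Set ℓ} {_≈_ : B → B → Set ℓ′}
  {P : A → Set p} {Q : B → Set q} {ρ : Level} {I : A → B → Set ρ} → ∀ {k l r s} →
  IsEquivalence _~_ → IsEquivalence _≈_ →
  (∀ {x x′ y} → x ~ x′ → I x y → I x′ y) → (∀ {x y y′} → P x → y ≈ y′ → I x y → I x y′) →
  Enum _~_ P k → (∀ x → P x → Enum _≈_ (λ y → Q y × I x y) r) →
  Enum _≈_ Q l → (∀ y → Q y → Enum _~_ (λ x → P x × I x y) s) →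
  k * r ≡ l * s
double-count {_~_ = _~_} {_≈_} {P} {Q} {I = I} eqA eqB respA respB E F E′ F′ =
  enum-unique (×-isEquivalence eqA eqB)
    (λ _ (px , qy , ixy) → qy , px , ixy) (λ _ (qy , px , ixy) → px , qy , ixy)
    (enum-Σ A.sym (λ x~ (qy , ixy) → qy , respA x~ ixy) E F)
    (enum-map {Q = λ (x , y) → Q y × P x × I x y}
      (λ (e , e′) (f , f′) → A.trans e f , B.trans e′ f′) swap swap (λ _ _ → swap) (λ _ z → z)
      (λ (x , y) z → (y , x) , z , A.refl , B.refl)
      (enum-Σ B.sym (λ y≈ (px , ixy) → px , respB px y≈ ixy) E′ F′))
  where module A = IsEquivalence eqA
        module B = IsEquivalence eqB

-- Repetitions in e are allowed, so this both filters and removes duplicates.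
select : {_~_ : A → A → Set ℓ} → IsEquivalence _~_ → (∀ x y → Dec (x ~ y)) →
  {Q : A → Set q} → (∀ x → Dec (Q x)) → (∀ {x y} → x ~ y → Q x → Q y) →
  ∀ {k} (e : Fin k → A) → Σ ℕ λ m → Enum _~_ (λ x → Q x × Σ (Fin k) λ i → x ~ e i) m
select eq _~?_ Q? Q-resp {zero} e = 0 , enum-empty λ { _ (_ , () , _) }
select {_~_ = _~_} eq _~?_ {Q} Q? Q-resp {suc k} e
  with select eq _~?_ Q? Q-resp (e ∘ suc)
     | Q? (e zero) ×-dec ¬? (Finₚ.any? λ i → e zero ~? e (suc i))
... | m , E | yes (q₀ , new) = suc m , enum-⇔
  (λ { x (inj₁ (qx , x~)) → qx , zero , x~ ; x (inj₂ (qx , i , x~)) → qx , suc i , x~ })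
  (λ { x (qx , zero , x~) → inj₁ (qx , x~) ; x (qx , suc i , x~) → inj₂ (qx , i , x~) })
  (enum-⊎ (IsEquivalence.sym eq)
    (λ { (_ , x~) (_ , i , y~) x~y → new (i , ~.trans (~.sym x~) (~.trans x~y y~)) })
    (enum-singleton {P = λ x → Q x × x ~ e zero} (e zero) (q₀ , ~.refl) (λ _ → proj₂)) E)
  where module ~ = IsEquivalence eq
... | m , E | no old = m , enum-⇔
  (λ { x (qx , i , x~) → qx , suc i , x~ })
  (λ { x (qx , suc i , x~) → qx , i , x~
     ; x (qx , zero , x~) → qx , earlier qx x~ })
  E
  where
  module ~ = IsEquivalence eq
  earlier : ∀ {x} → Q x → x ~ e zero → Σ (Fin k) λ i → x ~ e (suc i)
  earlier qx x~ with Finₚ.any? (λ i → e zero ~? e (suc i))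
  ... | yes (i , eq′) = i , ~.trans x~ eq′
  ... | no none = contradiction (Q-resp x~ qx , none) old

enum-filter : {_~_ : A → A → Set ℓ} {P : A → Set p} → IsEquivalence _~_ → (∀ x y → Dec (x ~ y)) →
  (∀ {x y} → x ~ y → P x → P y) →
  {Q : A → Set q} → (∀ x → Dec (Q x)) → (∀ {x y} → x ~ y → Q x → Q y) →
  Enum _~_ P k → Σ ℕ λ m → Enum _~_ (λ x → P x × Q x) m
enum-filter eq dec P-resp Q? Q-resp E =
  let m , E′ = select eq dec Q? Q-resp (elt E) in
  m , enum-⇔
    (λ x (qx , i , x~) → P-resp (IsEquivalence.sym eq x~) (sound E i) , qx)
    (λ x (px , qx) → qx , complete E x px) E′

enum-Fin : ∀ k → Enum _≡_ (λ (_ : Fin k) → ⊤) k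
enum-Fin k = record { elt = id ; injective = id ; sound = λ _ → tt ; complete = λ i _ → i , refl }

enum-Fin-< : ∀ {m d} → m ≤ d → Enum _≡_ (λ (i : Fin d) → toℕ i < m) m
enum-Fin-< {m} m≤d = record
  { elt = λ i → Fin.inject≤ i m≤d
  ; injective = Finₚ.inject≤-injective m≤d m≤d _ _
  ; sound = λ i → subst (_< m) (sym (Finₚ.toℕ-inject≤ i m≤d)) (Finₚ.toℕ<n i)
  ; complete = λ i i<m → Fin.fromℕ< i<m ,
      Finₚ.toℕ-injective (sym (trans (Finₚ.toℕ-inject≤ _ m≤d) (Finₚ.toℕ-fromℕ< i<m)))
  }

-- Pascal's rule: k pairs have `zero` as their smaller entry, and the others are the shifted pairs
-- of `Fin k`.
enum-Fin-pairs : ∀ k → Enum _≡_ (λ ((i , j) : Fin k × Fin k) → i Fin.< j) (k C 2)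
enum-Fin-pairs zero = enum-empty λ { (() , _) }
enum-Fin-pairs (suc k) = subst (Enum _ _)
  (trans (cong (_+ k C 2) (sym (nC1≡n k))) (nCk+nC[k+1]≡[n+1]C[k+1] k 1))
  (enum-⇔
    (λ { (_ , _) (inj₁ (refl , 0<j)) → 0<j ; _ (inj₂ (i , j , i<j , refl)) → s≤s i<j })
    (λ { (zero , suc j) _ → inj₁ (refl , s≤s z≤n) ; (suc i , suc j) (s≤s i<j) → inj₂ (i , j , i<j , refl) })
    (enum-⊎ sym (λ { {_ , _} (refl , _) (_ , _ , _ , refl) () })
      (enum-map {Q = λ (i , j) → i ≡ zero × zero {k} Fin.< j} trans
        (λ j → zero , suc j) (cong _) (λ { _ _ refl → refl })
        (λ _ _ → refl , s≤s z≤n) (λ { (_ , suc j) (refl , _) → j , tt , refl }) (enum-Fin k))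
      (enum-map {Q = λ w → Σ _ λ i → Σ _ λ j → i Fin.< j × w ≡ (suc i , suc j)} trans
        (λ (i , j) → suc i , suc j) (cong _) (λ { _ _ refl → refl })
        (λ _ i<j → _ , _ , i<j , refl) (λ { _ (i , j , i<j , refl) → (i , j) , i<j , refl })
        (enum-Fin-pairs k))))

-- Unordered pairs

UnorderedEq : {A : Set a} → (A → A → Set ℓ) → A × A → A × A → Set ℓ
UnorderedEq _~_ (x , y) (x′ , y′) = (x ~ x′ × y ~ y′) ⊎ (x ~ y′ × y ~ x′)

module _ {_~_ : A → A → Set ℓ} (eq : IsEquivalence _~_) where

  private module ~ = IsEquivalence eq

  unordered-isEquivalence : IsEquivalence (UnorderedEq _~_)
  unordered-isEquivalence = record
    { refl = inj₁ (~.refl , ~.refl)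
    ; sym = λ { (inj₁ (e , f)) → inj₁ (~.sym e , ~.sym f) ; (inj₂ (e , f)) → inj₂ (~.sym f , ~.sym e) }
    ; trans = λ { (inj₁ (e , f)) (inj₁ (e′ , f′)) → inj₁ (~.trans e e′ , ~.trans f f′)
                ; (inj₁ (e , f)) (inj₂ (e′ , f′)) → inj₂ (~.trans e e′ , ~.trans f f′)
                ; (inj₂ (e , f)) (inj₁ (e′ , f′)) → inj₂ (~.trans e f′ , ~.trans f e′)
                ; (inj₂ (e , f)) (inj₂ (e′ , f′)) → inj₁ (~.trans e f′ , ~.trans f e′) }
    }

  -- Each unordered pair is represented by the ordering in which the indices of its members
  -- increase; trichotomy on the indices selects it.
  enum-unordered-pairs : {P : A → Set p} → Enum _~_ P k →
    Enum (UnorderedEq _~_) (λ (x , y) → P x × P y × ¬ x ~ y) (k C 2)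
  enum-unordered-pairs {P = P} E = enum-map (IsEquivalence.trans unordered-isEquivalence)
    (λ (i , j) → elt E i , elt E j)
    (λ { refl → inj₁ (~.refl , ~.refl) })
    (λ { _ _ (inj₁ (e , f)) → cong₂ _,_ (injective E e) (injective E f)
       ; i<j i′<j′ (inj₂ (e , f)) → contradiction
           (Finₚ.<-trans i<j (subst₂ Fin._<_ (sym (injective E f)) (sym (injective E e)) i′<j′)) (Finₚ.<-irrefl refl) })
    (λ (i , j) i<j → sound E i , sound E j , λ eᵢ~eⱼ → Finₚ.<-irrefl (injective E eᵢ~eⱼ) i<j)
    from
    (enum-Fin-pairs _)
    where
    from : ∀ w → (P (proj₁ w) × P (proj₂ w) × ¬ proj₁ w ~ proj₂ w) →
      Σ _ λ ((i , j) : Fin _ × Fin _) → i Fin.< j × UnorderedEq _~_ w (elt E i , elt E j)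
    from (x , y) (px , py , x≁y) with complete E x px | complete E y py
    ... | i , x~ | j , y~ with Finₚ.<-cmp i j
    ... | tri< i<j _ _ = (i , j) , i<j , inj₁ (x~ , y~)
    ... | tri≈ _ refl _ = contradiction (~.trans x~ (~.sym y~)) x≁y
    ... | tri> _ _ j<i = (j , i) , j<i , inj₂ (x~ , y~)

  -- Every representative contributes itself and its swap. These never coincide: an equality between
  -- a representative and a swap forces equal indices, hence equal components, against `Q-distinct`.
  enum-ordered : {Q : A × A → Set q} → (∀ {x y x′ y′} → x ~ x′ → y ~ y′ → Q (x , y) → Q (x′ , y′)) →
    (∀ {x y} → Q (x , y) → Q (y , x)) → (∀ {x y} → Q (x , y) → ¬ x ~ y) →
    Enum (UnorderedEq _~_) Q k → Enum (Pointwise _~_ _~_) Q (k + k)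
  enum-ordered {k = k} {Q = Q} Q-resp Q-sym Q-distinct E = enum-⇔
    (λ { _ (inj₁ (i , e , f)) → Q-resp (~.sym e) (~.sym f) (sound E i)
       ; _ (inj₂ (i , e , f)) → Q-resp (~.sym e) (~.sym f) (Q-sym (sound E i)) })
    (λ w qw → let i , e = complete E w qw in [ (λ e → inj₁ (i , e)) , (λ e → inj₂ (i , e)) ]′ e)
    (enum-⊎ (IsEquivalence.sym pair-eq)
      (λ (i , e , f) (j , e′ , f′) (e″ , f″) → flipped i j
          (~.trans (~.sym e) (~.trans e″ e′) , ~.trans (~.sym f) (~.trans f″ f′)))
      (range (elt E) (λ ef → injective E (inj₁ ef)))
      (range (swap ∘ elt E) (λ ef → injective E (inj₁ (swap ef)))))
    where
    pair-eq : IsEquivalence (Pointwise _~_ _~_)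
    pair-eq = ×-isEquivalence eq eq
    range : (g : Fin k → A × A) → (∀ {i j} → Pointwise _~_ _~_ (g i) (g j) → i ≡ j) →
      Enum (Pointwise _~_ _~_) (λ w → Σ (Fin k) λ i → Pointwise _~_ _~_ w (g i)) k
    range g inj = record
      { elt = g ; injective = inj ; sound = λ i → i , ~.refl , ~.refl ; complete = λ _ z → z }
    flipped : ∀ i j → ¬ Pointwise _~_ _~_ (elt E i) (swap (elt E j))
    flipped i j ef with refl ← injective E {i} {j} (inj₂ ef) = Q-distinct (sound E i) (proj₁ ef)

-- Addition formula for C(m + n, 2) and 2-transitivity of the symmetric group

C2-+ : ∀ m n → (m + n) C 2 ≡ m C 2 + (m * n + n C 2)
C2-+ zero n = refl
C2-+ (suc m) n = begin
  suc (m + n) C 2                        ≡⟨ suc-C2 (m + n) ⟩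
  m + n + (m + n) C 2                    ≡⟨ cong (m + n +_) (C2-+ m n) ⟩
  m + n + (m C 2 + (m * n + n C 2))      ≡⟨ rearrange m n (m C 2) (m * n) (n C 2) ⟩
  m + m C 2 + (n + m * n + n C 2)        ≡⟨ cong (_+ (n + m * n + n C 2)) (suc-C2 m) ⟨
  suc m C 2 + (n + m * n + n C 2)        ∎
  where
  open ≡-Reasoning
  suc-C2 : ∀ k → suc k C 2 ≡ k + k C 2
  suc-C2 k = trans (sym (nCk+nC[k+1]≡[n+1]C[k+1] k 1)) (cong (_+ k C 2) (nC1≡n k))
  open +-*-Solver
  rearrange : ∀ m n a b c → m + n + (a + (b + c)) ≡ m + a + (n + b + c)
  rearrange = solve 5 (λ m n a b c → m :+ n :+ (a :+ (b :+ c)) := m :+ a :+ (n :+ b :+ c)) refl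

transpose-sends : ∀ {d} (i j : Fin d) → transpose i j ⟨$⟩ʳ i ≡ j
transpose-sends i j with i Finₚ.≟ i
... | yes _ = refl
... | no i≢i = contradiction refl i≢i

-- A transposition `τ` carries `i` to `i′`; a second one carries the image `u` of `j` to `j′`. The
-- second fixes `i′`, which differs from `j′` by assumption and from `u` by injectivity of `τ`.
two-transitive : ∀ {d} {i j i′ j′ : Fin d} → i ≢ j → i′ ≢ j′ →
  Σ (Permutation′ d) λ σ → (σ ⟨$⟩ʳ i ≡ i′) × (σ ⟨$⟩ʳ j ≡ j′)
two-transitive {i = i} {j} {i′} {j′} i≢j i′≢j′ =
  τ ∘ₚ transpose u j′ ,
  trans (cong (transpose u j′ ⟨$⟩ʳ_) τi≡i′) (fixes i′≢u i′≢j′) ,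
  transpose-sends u j′
  where
  τ : Permutation′ _
  τ = transpose i i′
  u : Fin _
  u = τ ⟨$⟩ʳ j
  fixes : ∀ {d} {i j k : Fin d} → k ≢ i → k ≢ j → transpose i j ⟨$⟩ʳ k ≡ k
  fixes {i = i} {j} {k} k≢i k≢j with k Finₚ.≟ i
  ... | yes k≡i = contradiction k≡i k≢i
  ... | no _ with k Finₚ.≟ j
  ...   | yes k≡j = contradiction k≡j k≢j
  ...   | no _ = refl
  τi≡i′ : τ ⟨$⟩ʳ i ≡ i′
  τi≡i′ = transpose-sends i i′
  i′≢u : i′ ≢ u
  i′≢u i′≡u = i≢j (begin
    i                  ≡⟨ Perm.inverseˡ τ ⟨
    τ ⟨$⟩ˡ (τ ⟨$⟩ʳ i)  ≡⟨ cong (τ ⟨$⟩ˡ_) (trans τi≡i′ i′≡u) ⟩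
    τ ⟨$⟩ˡ (τ ⟨$⟩ʳ j)  ≡⟨ Perm.inverseˡ τ ⟩
    j                  ∎)
    where open ≡-Reasoning

-- Primitive elements of finite fields

module PrimitiveElement
  (R : CommutativeRing 0ℓ 0ℓ) (isField : IsField R)
  (ζ : CommutativeRing.Carrier R) (prim : IsPrimitive R ζ)
  (N : ℕ) (order : HasOrder R (suc N)) (2≤N : 2 ≤ N) where

  open CommutativeRing R renaming (Carrier to F; _+_ to _+F_; _*_ to _*F_; refl to ≈-refl; sym to ≈-sym; trans to ≈-trans)
    hiding (zero)
  open RingProperties ring using (x∙y⁻¹≈ε⇒x≈y; -‿distribˡ-*; +-inverseˡ-unique)
  open SetoidReasoning setoid

  elements : Enum _≈_ (λ _ → ⊤) (suc N)
  elements = size⇒enum ≈-sym order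

  index : F → Fin (suc N)
  index x = proj₁ (complete elements x tt)

  index-injective : ∀ {x y} → index x ≡ index y → x ≈ y
  index-injective {x} {y} eq = ≈-trans (proj₂ (complete elements x tt))
    (≈-trans (reflexive (cong (elt elements) eq)) (≈-sym (proj₂ (complete elements y tt))))

  index-cong : ∀ {x y} → x ≈ y → index x ≡ index y
  index-cong {x} {y} x≈y = injective elements
    (≈-trans (≈-sym (proj₂ (complete elements x tt))) (≈-trans x≈y (proj₂ (complete elements y tt))))

  infix 4 _≟_
  _≟_ : ∀ x y → Dec (x ≈ y)
  x ≟ y = mapDec index-injective index-cong (index x Finₚ.≟ index y)

  *-cancelˡ : ∀ {x y z} → ¬ x ≈ 0# → x *F y ≈ x *F z → y ≈ z
  *-cancelˡ {x} {y} {z} x≉0 xy≈xz = let w , xw≈1 = proj₂ isField x x≉0 in begin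
    y               ≈⟨ *-identityˡ y ⟨
    1# *F y         ≈⟨ *-congʳ (≈-trans (*-comm w x) xw≈1) ⟨
    w *F x *F y     ≈⟨ *-assoc w x y ⟩
    w *F (x *F y)   ≈⟨ *-congˡ xy≈xz ⟩
    w *F (x *F z)   ≈⟨ *-assoc w x z ⟨
    w *F x *F z     ≈⟨ *-congʳ (≈-trans (*-comm w x) xw≈1) ⟩
    1# *F z         ≈⟨ *-identityˡ z ⟩
    z               ∎

  *-nonzero : ∀ {x y} → ¬ x ≈ 0# → ¬ y ≈ 0# → ¬ x *F y ≈ 0#
  *-nonzero x≉0 y≉0 xy≈0 = y≉0 (*-cancelˡ x≉0 (≈-trans xy≈0 (≈-sym (zeroʳ _))))

  infix 8 ζ^_
  ζ^_ : ℕ → F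
  ζ^ i = pow R ζ i

  -- `IsPrimitive` by itself admits ζ = 0 over the field with two elements, since the zeroth power
  -- is 1. With ζ = 0 every element would be 0 or 1, which contradicts the size N + 1 ≥ 3.
  ζ≉0 : ¬ ζ ≈ 0#
  ζ≉0 ζ≈0 = ℕₚ.<⇒≱ (s≤s 2≤N) (Finₚ.injective⇒≤ {f = f} f-injective)
    where
    power : ∀ i → ζ^ i ≈ 1# ⊎ ζ^ i ≈ 0#
    power zero = inj₁ ≈-refl
    power (suc i) = inj₂ (≈-trans (*-congʳ ζ≈0) (zeroˡ _))
    one : ∀ {x} → ¬ x ≈ 0# → x ≈ 1#
    one {x} x≉0 with prim x x≉0
    ... | i , ζⁱ≈x with power i
    ... | inj₁ ζⁱ≈1 = ≈-trans (≈-sym ζⁱ≈x) ζⁱ≈1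
    ... | inj₂ ζⁱ≈0 = contradiction (≈-trans (≈-sym ζⁱ≈x) ζⁱ≈0) x≉0
    f : Fin (suc N) → Fin 2
    f i with elt elements i ≟ 0#
    ... | yes _ = zero
    ... | no _ = suc zero
    f-injective : ∀ {i j} → f i ≡ f j → i ≡ j
    f-injective {i} {j} eq with elt elements i ≟ 0# | elt elements j ≟ 0#
    ... | yes x≈0 | yes y≈0 = injective elements (≈-trans x≈0 (≈-sym y≈0))
    ... | no x≉0 | no y≉0 = injective elements (≈-trans (one x≉0) (≈-sym (one y≉0)))

  ζ^≉0 : ∀ i → ¬ ζ^ i ≈ 0#
  ζ^≉0 zero = proj₁ isField
  ζ^≉0 (suc i) = *-nonzero ζ≉0 (ζ^≉0 i)

  ζ^-+ : ∀ i j → ζ^ (i + j) ≈ ζ^ i *F ζ^ j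
  ζ^-+ zero j = ≈-sym (*-identityˡ _)
  ζ^-+ (suc i) j = ≈-trans (*-congˡ (ζ^-+ i j)) (≈-sym (*-assoc ζ (ζ^ i) (ζ^ j)))

  ζ^-cong : ∀ {i j} → i ≡ j → ζ^ i ≈ ζ^ j
  ζ^-cong = reflexive ∘ cong ζ^_

  ζ^-multiple : ∀ {e} → ζ^ e ≈ 1# → ∀ q → ζ^ (q * e) ≈ 1#
  ζ^-multiple ζᵉ≈1 zero = ≈-refl
  ζ^-multiple {e} ζᵉ≈1 (suc q) = ≈-trans (ζ^-+ e (q * e)) (≈-trans (*-cong ζᵉ≈1 (ζ^-multiple ζᵉ≈1 q)) (*-identityˡ 1#))

  ζ^-% : ∀ {e} .{{_ : NonZero e}} → ζ^ e ≈ 1# → ∀ i → ζ^ i ≈ ζ^ (i % e)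
  ζ^-% {e} ζᵉ≈1 i = begin
    ζ^ i                             ≈⟨ ζ^-cong (m≡m%n+[m/n]*n i e) ⟩
    ζ^ (i % e + i / e * e)           ≈⟨ ζ^-+ (i % e) _ ⟩
    ζ^ (i % e) *F ζ^ (i / e * e)     ≈⟨ *-congˡ (ζ^-multiple ζᵉ≈1 (i / e)) ⟩
    ζ^ (i % e) *F 1#                 ≈⟨ *-identityʳ _ ⟩
    ζ^ (i % e)                       ∎

  ζ^-∸ : ∀ {i j} → i ≤ j → ζ^ i ≈ ζ^ j → ζ^ (j ∸ i) ≈ 1#
  ζ^-∸ {i} {j} i≤j eq = *-cancelˡ (ζ^≉0 i) (begin
    ζ^ i *F ζ^ (j ∸ i)  ≈⟨ ζ^-+ i (j ∸ i) ⟨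
    ζ^ (i + (j ∸ i))    ≈⟨ ζ^-cong (ℕₚ.m+[n∸m]≡n i≤j) ⟩
    ζ^ j                ≈⟨ eq ⟨
    ζ^ i                ≈⟨ *-identityʳ _ ⟨
    ζ^ i *F 1#          ∎)

  -- If ζᵉ ≈ 1 then x ↦ log x mod e embeds the N nonzero elements into Fin e.
  order-minimal : ∀ e .{{_ : NonZero e}} → ζ^ e ≈ 1# → N ≤ e
  order-minimal e ζᵉ≈1 = ℕₚ.≤-pred (Finₚ.injective⇒≤ {f = λ i → f (elt elements i)}
    (λ {i} {j} eq → injective elements (f-injective (elt elements i) (elt elements j) eq)))
    where
    f : F → Fin (suc e)
    f x with x ≟ 0#
    ... | yes _ = zero
    ... | no x≉0 = suc (Fin.fromℕ< (m%n<n (proj₁ (prim x x≉0)) e))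
    f-injective : ∀ x y → f x ≡ f y → x ≈ y
    f-injective x y eq with x ≟ 0# | y ≟ 0#
    ... | yes x≈0 | yes y≈0 = ≈-trans x≈0 (≈-sym y≈0)
    ... | no x≉0 | no y≉0 = let i , ζⁱ≈x = prim x x≉0 ; j , ζʲ≈y = prim y y≉0 in begin
      x           ≈⟨ ζⁱ≈x ⟨
      ζ^ i        ≈⟨ ζ^-% ζᵉ≈1 i ⟩
      ζ^ (i % e)  ≈⟨ ζ^-cong (Finₚ.fromℕ<-injective _ _ (m%n<n i e) (m%n<n j e) (Finₚ.suc-injective eq)) ⟩
      ζ^ (j % e)  ≈⟨ ζ^-% ζᵉ≈1 j ⟨
      ζ^ j        ≈⟨ ζʲ≈y ⟩
      y           ∎

  -- The N + 1 powers with exponents from 0 to N lie among N nonzero elements, so two agree and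
  -- their exponents differ by some e ≤ N with ζᵉ = 1. By `order-minimal`, e = N.
  ζ^N≈1 : ζ^ N ≈ 1#
  ζ^N≈1 = let i , j , i<j , eq = Finₚ.pigeonhole (ℕₚ.n<1+n N) f in period (toℕ i) (toℕ j) i<j (Finₚ.toℕ≤pred[n] j)
                (index-injective (Finₚ.punchOut-injective (0≢ (toℕ i)) (0≢ (toℕ j)) eq))
    where
    0≢ : ∀ i → index 0# ≢ index (ζ^ i)
    0≢ i eq = ζ^≉0 i (≈-sym (index-injective eq))
    f : Fin (suc N) → Fin N
    -- `punchOut` drops the index of 0, which no power of ζ attains.
    f i = Fin.punchOut (0≢ (toℕ i))
    period : ∀ i j → i < j → j ≤ N → ζ^ i ≈ ζ^ j → ζ^ N ≈ 1#
    period i j i<j j≤N eq =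
      subst (λ e → ζ^ e ≈ 1#) (ℕₚ.≤-antisym (ℕₚ.≤-trans (ℕₚ.m∸n≤m j i) j≤N) N≤) ζᵉ≈1
      where
      ζᵉ≈1 : ζ^ (j ∸ i) ≈ 1#
      ζᵉ≈1 = ζ^-∸ (ℕₚ.<⇒≤ i<j) eq
      N≤ : N ≤ j ∸ i
      N≤ = order-minimal (j ∸ i) {{>-nonZero (ℕₚ.m<n⇒0<n∸m i<j)}} ζᵉ≈1

  ζ^-injective : ∀ {i j} → i < N → j < N → ζ^ i ≈ ζ^ j → i ≡ j
  ζ^-injective {i} {j} i<N j<N eq with ℕₚ.<-cmp i j
  ... | tri≈ _ i≡j _ = i≡j
  ... | tri< i<j _ _ = contradiction (order-minimal (j ∸ i) {{>-nonZero (ℕₚ.m<n⇒0<n∸m i<j)}}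
      (ζ^-∸ (ℕₚ.<⇒≤ i<j) eq)) (ℕₚ.<⇒≱ (ℕₚ.≤-<-trans (ℕₚ.m∸n≤m j i) j<N))
  ... | tri> _ _ j<i = contradiction (order-minimal (i ∸ j) {{>-nonZero (ℕₚ.m<n⇒0<n∸m j<i)}}
      (ζ^-∸ (ℕₚ.<⇒≤ j<i) (≈-sym eq))) (ℕₚ.<⇒≱ (ℕₚ.≤-<-trans (ℕₚ.m∸n≤m i j) i<N))

  instance
    N-nonZero : NonZero N
    N-nonZero = >-nonZero (ℕₚ.≤-trans (s≤s z≤n) 2≤N)

  -- Exponents are determined modulo N, hence modulo every divisor of N. For m = n this separates
  -- the cosets of ⟨ζⁿ⟩.
  ζ^-≡% : ∀ {m} .{{_ : NonZero m}} → m ∣ N → ∀ i j → ζ^ i ≈ ζ^ j → i % m ≡ j % m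
  ζ^-≡% {m} m∣N i j eq =
    trans (sym (m∣n⇒o%n%m≡o%m m N i m∣N)) (trans (cong (_% m)
      (ζ^-injective (m%n<n i N) (m%n<n j N) (≈-trans (≈-sym (ζ^-% {N} ζ^N≈1 i)) (≈-trans eq (ζ^-% {N} ζ^N≈1 j)))))
      (m∣n⇒o%n%m≡o%m m N j m∣N))

  -- (ζʰ - 1)(ζʰ + 1) ≈ 0 while ζʰ ≉ 1.
  ζ^half≈-1 : ∀ h → h + h ≡ N → ζ^ h ≈ - 1#
  ζ^half≈-1 h h+h≡N = +-inverseˡ-unique _ _ (*-cancelˡ u≉0 (begin
    u *F (ζ^ h +F 1#)                 ≈⟨ distribʳ (ζ^ h +F 1#) (ζ^ h) (- 1#) ⟩
    ζ^ h *F (ζ^ h +F 1#) +F - 1# *F (ζ^ h +F 1#)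
      ≈⟨ +-cong (distribˡ _ _ _) (≈-trans (≈-sym (-‿distribˡ-* 1# _)) (-‿cong (*-identityˡ _))) ⟩
    ζ^ h *F ζ^ h +F ζ^ h *F 1# +F - (ζ^ h +F 1#)
      ≈⟨ +-congʳ (+-cong (≈-trans (≈-sym (ζ^-+ h h)) (≈-trans (ζ^-cong h+h≡N) ζ^N≈1)) (*-identityʳ _)) ⟩
    1# +F ζ^ h +F - (ζ^ h +F 1#)      ≈⟨ +-congʳ (+-comm _ _) ⟩
    ζ^ h +F 1# +F - (ζ^ h +F 1#)      ≈⟨ -‿inverseʳ _ ⟩
    0#                                ≈⟨ zeroʳ u ⟨
    u *F 0#                           ∎))
    where
    u : F
    u = ζ^ h +F - 1#
    0<h : 0 < h
    0<h = ℕₚ.n≢0⇒n>0 λ { refl → contradiction (subst (2 ≤_) (sym h+h≡N) 2≤N) λ () }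
    h<N : h < N
    h<N = subst (h <_) h+h≡N (ℕₚ.m<m+n h 0<h)
    u≉0 : ¬ u ≈ 0#
    u≉0 u≈0 = ℕₚ.<⇒≱ h<N (order-minimal h {{>-nonZero 0<h}} (x∙y⁻¹≈ε⇒x≈y (ζ^ h) 1# u≈0))

-- Finite covers of function and permutation types

-- Unlike in `Enum`, repetitions are permitted, so closure under products, function spaces and maps
-- needs neither injectivity nor decidability. `select` removes the duplicates later.
Cover : (A : Set a) → (A → A → Set ℓ) → Set (a ⊔ ℓ)
Cover A _~_ = Σ ℕ λ m → Σ (Fin m → A) λ e → ∀ x → Σ (Fin m) λ i → x ~ e i

enum⇒cover : ∀ {A : Set a} {_~_ : A → A → Set ℓ} {k} → Enum _~_ (λ _ → ⊤) k → Cover A _~_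
enum⇒cover E = _ , elt E , λ x → complete E x tt

-- `f` need not respect `_~_`. Since the cover supplies only some member of the class of `x`, it is
-- enough that each `y` has an `x` all of whose equivalents are sent to equivalents of `y`.
cover-map : ∀ {A : Set a} {B : Set b} {_~_ : A → A → Set ℓ} {_≈_ : B → B → Set ℓ′} (f : A → B) →
  (∀ y → Σ A λ x → ∀ x′ → x ~ x′ → y ≈ f x′) → Cover A _~_ → Cover B _≈_
cover-map f lift (m , e , covers) = m , f ∘ e , λ y →
  let x , x↦y = lift y ; i , x~ = covers x in i , x↦y (e i) x~

cover-× : ∀ {A : Set a} {B : Set b} {_~_ : A → A → Set ℓ} {_≈_ : B → B → Set ℓ′} →
  Cover A _~_ → Cover B _≈_ → Cover (A × B) (Pointwise _~_ _≈_)
cover-× {A = A} {B} {_~_} {_≈_} (m , e , covers) (m′ , e′ , covers′) = m * m′ , pair ∘ Fin.remQuot {m} m′ ,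
  λ (x , y) → let i , x~ = covers x ; j , y≈ = covers′ y in Fin.combine i j ,
    subst (λ w → Pointwise _~_ _≈_ (x , y) (pair w)) (sym (Finₚ.remQuot-combine i j)) (x~ , y≈)
  where
  pair : Fin m × Fin m′ → A × B
  pair (i , j) = e i , e′ j

cover-→ : ∀ {A : Set a} {_~_ : A → A → Set ℓ} d → Cover A _~_ →
  Cover (Fin d → A) (λ f g → ∀ i → f i ~ g i)
cover-→ {_~_ = _~_} d (m , e , covers) = m ^ d , (λ w → e ∘ Fin.finToFun w) ,
  λ f → Fin.funToFin (proj₁ ∘ covers ∘ f) ,
    λ i → subst (λ j → f i ~ e j) (sym (Finₚ.finToFun-funToFin (proj₁ ∘ covers ∘ f) i)) (proj₂ (covers (f i)))

-- A permutation is coded by two functions, the forward map and a candidate inverse. Being mutually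
-- inverse is decidable on `Fin d`.
cover-permutations : ∀ d → Cover (Permutation′ d) (λ σ τ → (σ ⟨$⟩ʳ_) ≗ (τ ⟨$⟩ʳ_))
cover-permutations d = cover-map {_≈_ = λ σ τ → (σ ⟨$⟩ʳ_) ≗ (τ ⟨$⟩ʳ_)} toPermutation lift
  (cover-× {_~_ = _≗_} {_≈_ = _≗_} functions functions)
  where
  functions : Cover (Fin d → Fin d) _≗_
  functions = cover-→ {_~_ = _≡_} d (enum⇒cover (enum-Fin d))
  inverse? : ∀ (f g : Fin d → Fin d) → Dec ((∀ i → f (g i) ≡ i) × (∀ i → g (f i) ≡ i))
  inverse? f g = Finₚ.all? (λ i → f (g i) Finₚ.≟ i) ×-dec Finₚ.all? (λ i → g (f i) Finₚ.≟ i)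
  toPermutation : (Fin d → Fin d) × (Fin d → Fin d) → Permutation′ d
  toPermutation (f , g) with inverse? f g
  ... | yes (fg , gf) = permutation f g fg gf
  -- A default for pairs that are not mutually inverse; `lift′` shows that no such pair agrees
  -- pointwise with a permutation and its inverse.
  ... | no _ = Perm.id
  lift : ∀ σ → Σ _ λ x → ∀ x′ → _ → ∀ i → σ ⟨$⟩ʳ i ≡ toPermutation x′ ⟨$⟩ʳ i
  lift σ = ((σ ⟨$⟩ʳ_) , (σ ⟨$⟩ˡ_)) , lift′
    where
    lift′ : ∀ x′ → (∀ i → σ ⟨$⟩ʳ i ≡ proj₁ x′ i) × (∀ i → σ ⟨$⟩ˡ i ≡ proj₂ x′ i) →
      ∀ i → σ ⟨$⟩ʳ i ≡ toPermutation x′ ⟨$⟩ʳ i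
    lift′ (f , g) (σ≗f , σ⁻¹≗g) i with inverse? f g
    ... | yes _ = σ≗f i
    ... | no ¬inverse = contradiction
      ( (λ i → trans (sym (σ≗f (g i))) (trans (cong (σ ⟨$⟩ʳ_) (sym (σ⁻¹≗g i))) (Perm.inverseʳ σ)))
      , (λ i → trans (sym (σ⁻¹≗g (f i))) (trans (cong (σ ⟨$⟩ˡ_) (sym (σ≗f i))) (Perm.inverseˡ σ))))
      ¬inverse

-- The construction for c = 1 + nD, d = 1 + D and D = 2s

module Design
  (R : CommutativeRing 0ℓ 0ℓ) (isField : IsField R)
  (ζ : CommutativeRing.Carrier R) (prim : IsPrimitive R ζ)
  (n D′ k s : ℕ) (order : HasOrder R (suc (n * suc D′)))
  (2≤n : 2 ≤ n) (s+s≡D : s + s ≡ suc D′) (c+n≡kC2 : suc (n * suc D′) + n ≡ k C 2) (2n≤k : 2 * n ≤ k) where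

  D c d : ℕ
  D = suc D′
  c = suc (n * D)
  d = suc D

  n≤k : n ≤ k
  n≤k = ℕₚ.≤-trans (ℕₚ.m≤m+n n _) 2n≤k

  n≤k∸n : n ≤ k ∸ n
  n≤k∸n = subst (_≤ k ∸ n) (trans (ℕₚ.m+n∸m≡n n (n + 0)) (ℕₚ.+-identityʳ n)) (ℕₚ.∸-monoˡ-≤ n 2n≤k)

  2≤nD : 2 ≤ n * D
  2≤nD = ℕₚ.≤-trans 2≤n (ℕₚ.m≤m*n n D)

  instance
    n-nonZero : NonZero n
    n-nonZero = >-nonZero (ℕₚ.≤-trans (s≤s z≤n) 2≤n)

  -- Room for `B`, which meets k - n classes. With m = k - n, nd + 1 = C(k,2) = C(m,2) + mn + C(n,2)
  -- ≥ mn + 1, because C(n,2) ≥ 1 for n ≥ 2.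
  k∸n≤d : k ∸ n ≤ d
  k∸n≤d = ℕₚ.*-cancelʳ-≤ (k ∸ n) d n (ℕₚ.≤-pred (begin
    suc (m * n)                        ≡⟨ ℕₚ.+-comm 1 (m * n) ⟩
    m * n + 1                          ≤⟨ ℕₚ.+-monoʳ-≤ (m * n) 1≤nC2 ⟩
    m * n + n C 2                      ≤⟨ ℕₚ.m≤n+m _ (m C 2) ⟩
    m C 2 + (m * n + n C 2)            ≡⟨ C2-+ m n ⟨
    (m + n) C 2                        ≡⟨ cong (_C 2) (ℕₚ.m∸n+n≡m n≤k) ⟩
    k C 2                              ≡⟨ c+n≡kC2 ⟨
    suc (n * D + n)                    ≡⟨ cong suc (trans (ℕₚ.+-comm (n * D) n) (cong (n +_) (ℕₚ.*-comm n D))) ⟩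
    suc (d * n)                        ∎))
    where
    open ℕₚ.≤-Reasoning
    m = k ∸ n
    1≤nC2 : 1 ≤ n C 2
    1≤nC2 = subst (λ n → 1 ≤ n C 2) (ℕₚ.m+[n∸m]≡n 2≤n)
      (subst (1 ≤_) (sym (C2-+ 2 (n ∸ 2))) (s≤s z≤n))

  open CommutativeRing R
    renaming (Carrier to F; _+_ to _+F_; _*_ to _*F_; refl to ≈-refl; sym to ≈-sym; trans to ≈-trans;
              isEquivalence to ≈-isEquivalence)
    hiding (zero)
  open RingProperties ring using (+-cancelʳ; -‿distribˡ-*)
  open PrimitiveElement R isField ζ prim (n * D) order 2≤nD
  open Construction R ζ n c d k hiding (F; Conclusion)

  -- The affine group H

  ζ^ns≈-1 : ζ^ (n * s) ≈ - 1#
  ζ^ns≈-1 = ζ^half≈-1 (n * s) (trans (sym (ℕₚ.*-distribˡ-+ n s s)) (cong (n *_) s+s≡D))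

  ζ^n-+ : ∀ t t′ → ζ^ (n * (t + t′)) ≈ ζ^ (n * t) *F ζ^ (n * t′)
  ζ^n-+ t t′ = ≈-trans (ζ^-cong (ℕₚ.*-distribˡ-+ n t t′)) (ζ^-+ (n * t) (n * t′))

  actH-cong : ∀ h {x y} → x ≈ y → actH h x ≈ actH h y
  actH-cong h x≈y = +-congʳ (*-congˡ x≈y)

  actH-injective : ∀ h {x y} → actH h x ≈ actH h y → x ≈ y
  actH-injective (t , b) eq = *-cancelˡ (ζ^≉0 (n * t)) (+-cancelʳ b _ _ eq)

  actH-0 : ∀ t b → actH (t , b) 0# ≈ b
  actH-0 t b = ≈-trans (+-congʳ (zeroʳ _)) (+-identityˡ b)

  infixr 9 _∘H_
  _∘H_ : HElt → HElt → HElt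
  (t , b) ∘H (t′ , b′) = t + t′ , ζ^ (n * t) *F b′ +F b

  actH-∘ : ∀ h h′ x → actH (h ∘H h′) x ≈ actH h (actH h′ x)
  actH-∘ (t , b) (t′ , b′) x = begin
    ζ^ (n * (t + t′)) *F x +F (ζ^ (n * t) *F b′ +F b)            ≈⟨ +-assoc _ _ _ ⟨
    ζ^ (n * (t + t′)) *F x +F ζ^ (n * t) *F b′ +F b
      ≈⟨ +-congʳ (+-congʳ (≈-trans (*-congʳ (ζ^n-+ t t′)) (*-assoc _ _ _))) ⟩
    ζ^ (n * t) *F (ζ^ (n * t′) *F x) +F ζ^ (n * t) *F b′ +F b    ≈⟨ +-congʳ (distribˡ _ _ _) ⟨
    ζ^ (n * t) *F (ζ^ (n * t′) *F x +F b′) +F b                  ∎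
    where open SetoidReasoning setoid

  infix 10 _⁻¹H
  -- Exponents are natural numbers. Since ζⁿ has order D = D′ + 1, the product D′t stands for -t.
  _⁻¹H : HElt → HElt
  (t , b) ⁻¹H = D′ * t , - (ζ^ (n * (D′ * t)) *F b)

  actH-inverseˡ : ∀ h x → actH (h ⁻¹H) (actH h x) ≈ x
  actH-inverseˡ (t , b) x = begin
    z *F (ζ^ (n * t) *F x +F b) +F - (z *F b)        ≈⟨ +-congʳ (distribˡ _ _ _) ⟩
    z *F (ζ^ (n * t) *F x) +F z *F b +F - (z *F b)   ≈⟨ +-assoc _ _ _ ⟩
    z *F (ζ^ (n * t) *F x) +F (z *F b +F - (z *F b)) ≈⟨ +-cong (≈-sym (*-assoc _ _ _)) (-‿inverseʳ _) ⟩
    z *F ζ^ (n * t) *F x +F 0#                       ≈⟨ +-identityʳ _ ⟩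
    z *F ζ^ (n * t) *F x                             ≈⟨ *-congʳ z-inverse ⟩
    1# *F x                                          ≈⟨ *-identityˡ x ⟩
    x                                                ∎
    where
    open SetoidReasoning setoid
    z : F
    z = ζ^ (n * (D′ * t))
    exponent : n * (t + D′ * t) ≡ t * (n * D)
    exponent = solve 3 (λ n D′ t → n :* (t :+ D′ :* t) := t :* (n :* (con 1 :+ D′))) refl n D′ t
      where open +-*-Solver
    z-inverse : z *F ζ^ (n * t) ≈ 1#
    z-inverse = ≈-trans (*-comm _ _) (≈-trans (≈-sym (ζ^n-+ t (D′ * t)))
      (≈-trans (ζ^-cong exponent) (ζ^-multiple ζ^N≈1 t)))

  actH-inverseʳ : ∀ h x → actH h (actH (h ⁻¹H) x) ≈ x
  actH-inverseʳ h x = actH-injective (h ⁻¹H) (actH-inverseˡ h (actH (h ⁻¹H) x))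

  -- The exponents nt + i and nt′ + j agree modulo n because n divides the order nD of ζ, and i, j
  -- are already reduced.
  coset-unique : ∀ {t t′ i j} → i < n → j < n → ζ^ (n * t) *F ζ^ i ≈ ζ^ (n * t′) *F ζ^ j → i ≡ j
  coset-unique {t} {t′} {i} {j} i<n j<n eq =
    trans (sym (reduce i<n t)) (trans (ζ^-≡% (m∣m*n D) (i + t * n) (j + t′ * n) eq′) (reduce j<n t′))
    where
    reduce : ∀ {i} → i < n → ∀ t → (i + t * n) % n ≡ i
    reduce {i} i<n t = trans ([m+kn]%n≡m%n i t n) (m<n⇒m%n≡m i<n)
    shift : ∀ i t → ζ^ (i + t * n) ≈ ζ^ (n * t) *F ζ^ i
    shift i t = ≈-trans (ζ^-cong (trans (ℕₚ.+-comm i (t * n)) (cong (_+ i) (ℕₚ.*-comm t n)))) (ζ^-+ (n * t) i)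
    eq′ : ζ^ (i + t * n) ≈ ζ^ (j + t′ * n)
    eq′ = ≈-trans (shift i t) (≈-trans eq (≈-sym (shift j t′)))

  -- y - x is a power ζᵐ; the remainder of m modulo n names its coset of ⟨ζⁿ⟩, the quotient gives
  -- the factor from ⟨ζⁿ⟩.
  difference-coset : ∀ {x y} → ¬ x ≈ y →
    Σ ℕ λ i → i < n × Σ ℕ λ t → y ≈ ζ^ (n * t) *F ζ^ i +F x
  difference-coset {x} {y} x≉y with prim (y +F - x) (λ y-x≈0 → x≉y (≈-sym (RingProperties.x∙y⁻¹≈ε⇒x≈y ring y x y-x≈0)))
  ... | m , ζᵐ≈ = m % n , m%n<n m n , m / n , (begin
    y                                             ≈⟨ +-identityʳ y ⟨
    y +F 0#                                       ≈⟨ +-congˡ (-‿inverseˡ x) ⟨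
    y +F (- x +F x)                               ≈⟨ +-assoc _ _ _ ⟨
    y +F - x +F x                                 ≈⟨ +-congʳ ζᵐ≈ ⟨
    ζ^ m +F x                                     ≈⟨ +-congʳ (ζ^-cong exponent) ⟩
    ζ^ (n * (m / n) + m % n) +F x                 ≈⟨ +-congʳ (ζ^-+ (n * (m / n)) _) ⟩
    ζ^ (n * (m / n)) *F ζ^ (m % n) +F x           ∎)
    where
    open SetoidReasoning setoid
    exponent : m ≡ n * (m / n) + m % n
    exponent = trans (m≡m%n+[m/n]*n m n) (trans (ℕₚ.+-comm (m % n) _) (cong (_+ m % n) (ℕₚ.*-comm (m / n) n)))

  negate-coset : ∀ t i → ζ^ (n * (s + t)) *F ζ^ i ≈ - (ζ^ (n * t) *F ζ^ i)
  negate-coset t i = begin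
    ζ^ (n * (s + t)) *F ζ^ i              ≈⟨ *-congʳ (≈-trans (ζ^n-+ s t) (*-congʳ ζ^ns≈-1)) ⟩
    - 1# *F ζ^ (n * t) *F ζ^ i            ≈⟨ *-assoc _ _ _ ⟩
    - 1# *F (ζ^ (n * t) *F ζ^ i)          ≈⟨ -‿distribˡ-* _ _ ⟨
    - (1# *F (ζ^ (n * t) *F ζ^ i))        ≈⟨ -‿cong (*-identityˡ _) ⟩
    - (ζ^ (n * t) *F ζ^ i)                ∎
    where open SetoidReasoning setoid

  -- Exponents are identified when they give the same power of ζⁿ, so the infinite type ℕ has as
  -- many classes as ⟨ζⁿ⟩ has elements.
  exponents : Enum (λ t t′ → ζ^ (n * t) ≈ ζ^ (n * t′)) (λ _ → ⊤) D
  exponents = record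
    { elt = toℕ
    ; injective = λ {i} {j} eq → Finₚ.toℕ-injective (ℕₚ.*-cancelˡ-≡ _ _ n
        (ζ^-injective (ℕₚ.*-monoʳ-< n (Finₚ.toℕ<n i)) (ℕₚ.*-monoʳ-< n (Finₚ.toℕ<n j)) eq))
    ; sound = λ _ → tt
    ; complete = λ t _ → Fin.fromℕ< (m%n<n t D) , (begin
        ζ^ (n * t)                               ≈⟨ ζ^-cong (exponent t) ⟩
        ζ^ (n * (t % D) + t / D * (n * D))       ≈⟨ ζ^-+ (n * (t % D)) _ ⟩
        ζ^ (n * (t % D)) *F ζ^ (t / D * (n * D)) ≈⟨ *-congˡ (ζ^-multiple ζ^N≈1 (t / D)) ⟩
        ζ^ (n * (t % D)) *F 1#                   ≈⟨ *-identityʳ _ ⟩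
        ζ^ (n * (t % D))                         ≈⟨ ζ^-cong (cong (n *_) (Finₚ.toℕ-fromℕ< (m%n<n t D))) ⟨
        ζ^ (n * toℕ (Fin.fromℕ< (m%n<n t D)))    ∎)
    }
    where
    open SetoidReasoning setoid
    exponent : ∀ t → n * t ≡ n * (t % D) + t / D * (n * D)
    exponent t = trans (cong (n *_) (m≡m%n+[m/n]*n t D))
      (solve 4 (λ n r q D → n :* (r :+ q :* D) := n :* r :+ q :* (n :* D)) refl n (t % D) (t / D) D)
      where open +-*-Solver

  -- The diagonal is one orbit. For x ≠ y the coset of y - x is a complete invariant: H translates x
  -- to 0 and multiplies the difference by any power of ζⁿ.
  rankH : Enum RankRelH (λ _ → ⊤) (suc n)
  rankH = record
    { elt = rep ; injective = λ {i} {j} → rep-injective i j ; sound = λ _ → tt ; complete = λ w _ → covers w }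
    where
    rep : Fin (suc n) → F × F
    rep zero = 0# , 0#
    rep (suc i) = 0# , ζ^ toℕ i
    rep-injective : ∀ i j → RankRelH (rep i) (rep j) → i ≡ j
    rep-injective zero zero _ = refl
    rep-injective zero (suc j) (_ , e , f) = contradiction (≈-trans (≈-sym f) e) (ζ^≉0 (toℕ j))
    rep-injective (suc i) zero (h , e , f) =
      contradiction (actH-injective h (≈-trans f (≈-sym e))) (ζ^≉0 (toℕ i))
    rep-injective (suc i) (suc j) ((t , b) , e , f) = cong suc (Finₚ.toℕ-injective
      (coset-unique {t} {0} (Finₚ.toℕ<n i) (Finₚ.toℕ<n j) (begin
        ζ^ (n * t) *F ζ^ toℕ i          ≈⟨ +-identityʳ _ ⟨
        ζ^ (n * t) *F ζ^ toℕ i +F 0#    ≈⟨ +-congˡ (≈-trans (≈-sym e) (actH-0 t b)) ⟩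
        ζ^ (n * t) *F ζ^ toℕ i +F b     ≈⟨ f ⟩
        ζ^ toℕ j                        ≈⟨ *-identityˡ _ ⟨
        1# *F ζ^ toℕ j                  ≈⟨ *-congʳ (ζ^-cong (sym (ℕₚ.*-zeroʳ n))) ⟩
        ζ^ (n * 0) *F ζ^ toℕ j          ∎)))
      where open SetoidReasoning setoid
    covers : ∀ w → Σ _ λ i → RankRelH w (rep i)
    covers (x , y) with x ≟ y
    ... | yes x≈y = zero , (0 , x) ⁻¹H , to-0 , ≈-trans (actH-cong ((0 , x) ⁻¹H) (≈-sym x≈y)) to-0
      where
      to-0 : actH ((0 , x) ⁻¹H) x ≈ 0#
      to-0 = ≈-trans (actH-cong ((0 , x) ⁻¹H) (≈-sym (actH-0 0 x))) (actH-inverseˡ (0 , x) 0#)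
    -- The element (t , x) sends 0 to x and ζⁱ to y, so its inverse normalises the pair.
    ... | no x≉y = let i , i<n , t , y≈ = difference-coset x≉y in
      suc (Fin.fromℕ< i<n) , (t , x) ⁻¹H ,
      ≈-trans (actH-cong ((t , x) ⁻¹H) (≈-sym (actH-0 t x))) (actH-inverseˡ (t , x) 0#) ,
      ≈-trans (actH-cong ((t , x) ⁻¹H) y≈)
        (≈-trans (actH-inverseˡ (t , x) (ζ^ i)) (ζ^-cong (sym (Finₚ.toℕ-fromℕ< i<n))))

  -- Swapping a pair negates its difference. As -1 lies in ⟨ζⁿ⟩, no two nondiagonal orbits fuse.
  pairRankH : Enum PairRelH (λ (x , y) → ¬ x ≈ y) n
  pairRankH = record
    { elt = λ i → 0# , ζ^ toℕ i
    ; injective = λ { {i} {j} ((h , inj₁ ef)) → Finₚ.suc-injective (injective rankH {suc i} {suc j} (h , ef))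
                    ; {i} {j} (((t , b) , inj₂ (e , f))) → reversed i j t b e f }
    ; sound = λ i 0≈ζⁱ → ζ^≉0 (toℕ i) (≈-sym 0≈ζⁱ)
    ; complete = covers
    }
    where
    open SetoidReasoning setoid
    reversed : ∀ (i j : Fin n) t b → actH (t , b) 0# ≈ ζ^ toℕ j → actH (t , b) (ζ^ toℕ i) ≈ 0# → i ≡ j
    -- The exponent `s` carries the sign, by `ζ^ns≈-1`.
    reversed i j t b e f = Finₚ.toℕ-injective (coset-unique {t} {s} (Finₚ.toℕ<n i) (Finₚ.toℕ<n j) (begin
      ζ^ (n * t) *F ζ^ toℕ i     ≈⟨ RingProperties.+-inverseˡ-unique ring _ _ f ⟩
      - b                        ≈⟨ -‿cong (≈-trans (≈-sym (actH-0 t b)) e) ⟩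
      - ζ^ toℕ j                 ≈⟨ -‿cong (*-identityˡ _) ⟨
      - (1# *F ζ^ toℕ j)         ≈⟨ -‿distribˡ-* _ _ ⟩
      - 1# *F ζ^ toℕ j           ≈⟨ *-congʳ ζ^ns≈-1 ⟨
      ζ^ (n * s) *F ζ^ toℕ j     ∎))
    covers : ∀ w → ¬ proj₁ w ≈ proj₂ w → Σ (Fin n) λ i → PairRelH w (0# , ζ^ toℕ i)
    covers (x , y) x≉y with complete rankH (x , y) tt
    ... | zero , h , e , f = contradiction (actH-injective h (≈-trans e (≈-sym f))) x≉y
    ... | suc i , h , ef = i , h , inj₁ ef

  -- Rank and pair rank of Sym(d)

  rankK : Enum RankRelK (λ _ → ⊤) 2
  rankK = record
    { elt = rep ; injective = λ {i} {j} → rep-injective i j ; sound = λ _ → tt ; complete = λ w _ → covers w }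
    where
    rep : Fin 2 → Fin d × Fin d
    rep zero = zero , zero
    rep (suc zero) = zero , suc zero
    rep-injective : ∀ i j → RankRelK (rep i) (rep j) → i ≡ j
    rep-injective zero zero _ = refl
    rep-injective (suc zero) (suc zero) _ = refl
    rep-injective zero (suc zero) (_ , e , f) = contradiction (trans (sym e) f) λ ()
    rep-injective (suc zero) zero (σ , e , f) = contradiction
      (trans (sym (Perm.inverseˡ σ)) (trans (cong (σ ⟨$⟩ˡ_) (trans e (sym f))) (Perm.inverseˡ σ))) λ ()
    covers : ∀ w → Σ _ λ i → RankRelK w (rep i)
    covers (i , j) with i Finₚ.≟ j
    ... | yes refl = zero , transpose i zero , transpose-sends i zero , transpose-sends i zero
    ... | no i≢j = suc zero , two-transitive i≢j λ ()

  pairRankK : Enum PairRelK (λ (i , j) → ¬ i ≡ j) 1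
  pairRankK = enum-singleton (zero , suc zero) (λ ())
    (λ _ i≢j → let σ , ef = two-transitive i≢j (λ ()) in σ , inj₁ ef)

  -- The wreath product G and its blocks

  PP : Set
  PP = Point × Point

  points-isEquivalence : IsEquivalence _≈P_
  points-isEquivalence = ×-isEquivalence ≈-isEquivalence isEquivalence

  module P = IsEquivalence points-isEquivalence

  infix 4 _≈PP_ _≟P_ _≟UP_
  _≈PP_ : PP → PP → Set
  _≈PP_ = Pointwise _≈P_ _≈P_

  _≟P_ : ∀ p q → Dec (p ≈P q)
  (x , i) ≟P (y , j) = x ≟ y ×-dec i Finₚ.≟ j

  _≟UP_ : ∀ v w → Dec (v ≈UP w)
  (p , q) ≟UP (p′ , q′) = (p ≟P p′ ×-dec q ≟P q′) ⊎-dec (p ≟P q′ ×-dec q ≟P p′)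

  points : Enum _≈P_ (λ _ → ⊤) (c * d)
  points = enum-⇔ _ (λ _ _ → tt , tt)
    (enum-Σ {I = λ _ _ → ⊤} ≈-sym (λ _ _ → tt) elements (λ _ _ → enum-Fin d))

  actG-cong : ∀ g {p q} → p ≈P q → actG g p ≈P actG g q
  actG-cong (hs , σ) {_ , j} (x≈y , refl) = actH-cong (hs j) x≈y , refl

  infixr 9 _∘G_
  _∘G_ : GElt → GElt → GElt
  (hs , σ) ∘G (hs′ , σ′) = (λ j → hs (σ′ ⟨$⟩ʳ j) ∘H hs′ j) , σ′ ∘ₚ σ

  actG-∘ : ∀ g h p → actG (g ∘G h) p ≈P actG g (actG h p)
  actG-∘ (hs , σ) (hs′ , σ′) (x , j) = actH-∘ (hs (σ′ ⟨$⟩ʳ j)) (hs′ j) x , refl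

  infix 10 _⁻¹G
  _⁻¹G : GElt → GElt
  (hs , σ) ⁻¹G = (λ j → hs (σ ⟨$⟩ˡ j) ⁻¹H) , flip σ

  actG-inverseˡ : ∀ g p → actG (g ⁻¹G) (actG g p) ≈P p
  actG-inverseˡ (hs , σ) (x , j) = cancel (Perm.inverseˡ σ) , Perm.inverseˡ σ
    where
    cancel : ∀ {i} → i ≡ j → actH (hs i ⁻¹H) (actH (hs j) x) ≈ x
    cancel refl = actH-inverseˡ (hs j) x

  actG-inverseʳ : ∀ g p → actG g (actG (g ⁻¹G) p) ≈P p
  actG-inverseʳ (hs , σ) (x , j) = actH-inverseʳ (hs (σ ⟨$⟩ˡ j)) x , Perm.inverseʳ σ

  actG-injective : ∀ g {p q} → actG g p ≈P actG g q → p ≈P q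
  actG-injective g eq =
    P.trans (P.sym (actG-inverseˡ g _)) (P.trans (actG-cong (g ⁻¹G) eq) (actG-inverseˡ g _))

  point-transitive : ∀ p q → Σ GElt λ g → actG g p ≈P q
  point-transitive p q = g q ∘G g p ⁻¹G , P.trans (actG-∘ (g q) (g p ⁻¹G) p)
    (P.trans (actG-cong (g q) (P.trans (actG-cong (g p ⁻¹G) (P.sym (g-sends p))) (actG-inverseˡ (g p) (0# , zero)))) (g-sends q))
    where
    g : Point → GElt
    g (x , j) = (λ _ → 0 , x) , transpose zero j
    g-sends : ∀ p → actG (g p) (0# , zero) ≈P p
    g-sends (x , j) = actH-0 0 x , refl

  -- GElt is infinite, since exponents of ζⁿ are not reduced; only its action is finite.
  GCover : Cover GElt (λ g h → ∀ p → actG g p ≈P actG h p)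
  GCover = cover-map {_~_ = Pointwise _≗H_ _≗σ_} {_≈_ = λ g h → ∀ p → actG g p ≈P actG h p} id
    (λ (hs , σ) → (hs , σ) , λ (hs′ , σ′) (hs~ , σ~) (x , j) →
      +-cong (*-congʳ (proj₁ (hs~ j))) (proj₂ (hs~ j)) , σ~ j)
    (cover-× {_~_ = _≗H_} {_≈_ = _≗σ_}
      (cover-→ {_~_ = _~H_} d (cover-× {_~_ = _~ℕ_} {_≈_ = _≈_} (enum⇒cover exponents) (enum⇒cover elements)))
      (cover-permutations d))
    where
    _~ℕ_ : ℕ → ℕ → Set
    t ~ℕ t′ = ζ^ (n * t) ≈ ζ^ (n * t′)
    _~H_ : HElt → HElt → Set
    _~H_ = Pointwise _~ℕ_ _≈_
    _≗H_ : (Fin d → HElt) → (Fin d → HElt) → Set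
    hs ≗H hs′ = ∀ j → hs j ~H hs′ j
    _≗σ_ : KElt → KElt → Set
    σ ≗σ τ = (σ ⟨$⟩ʳ_) ≗ (τ ⟨$⟩ʳ_)

  -- A `PSet` may distinguish equal points. Images and blocks never do, and only for such sets does
  -- g⁻¹ undo the image under g up to `_≋_`.
  Extensional : PSet → Set
  Extensional S = ∀ {p q} → p ≈P q → S p → S q

  ≋-isEquivalence : IsEquivalence _≋_
  ≋-isEquivalence = record
    { refl = λ _ → id , id
    ; sym = λ S≋T p → swap (S≋T p)
    ; trans = λ S≋T T≋U p → proj₁ (T≋U p) ∘ proj₁ (S≋T p) , proj₂ (S≋T p) ∘ proj₂ (T≋U p)
    }

  module ≋ = IsEquivalence ≋-isEquivalence

  image-extensional : ∀ g S → Extensional (image g S)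
  image-extensional g S p≈q (r , Sr , gr≈p) = r , Sr , P.trans gr≈p p≈q

  image-cong : ∀ g {S T} → S ≋ T → image g S ≋ image g T
  image-cong g S≋T p = (λ (q , Sq , e) → q , proj₁ (S≋T q) Sq , e) , (λ (q , Tq , e) → q , proj₂ (S≋T q) Tq , e)

  image-cong-act : ∀ {g h} S → (∀ p → actG g p ≈P actG h p) → image g S ≋ image h S
  image-cong-act S g≈h p =
    (λ (q , Sq , e) → q , Sq , P.trans (P.sym (g≈h q)) e) , (λ (q , Sq , e) → q , Sq , P.trans (g≈h q) e)

  image-∘ : ∀ g h S → image (g ∘G h) S ≋ image g (image h S)
  image-∘ g h S p =
    (λ (q , Sq , e) → actG h q , (q , Sq , P.refl) , P.trans (P.sym (actG-∘ g h q)) e) ,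
    (λ (r , (q , Sq , e) , e′) → q , Sq , P.trans (actG-∘ g h q) (P.trans (actG-cong g e) e′))

  image⁻ : ∀ g {S p} → Extensional S → image g S p → S (actG (g ⁻¹G) p)
  image⁻ g S-ext (q , Sq , e) = S-ext (P.trans (P.sym (actG-inverseˡ g q)) (actG-cong (g ⁻¹G) e)) Sq

  image⁺ : ∀ g {S p} → S (actG (g ⁻¹G) p) → image g S p
  image⁺ g {p = p} Sg⁻¹p = actG (g ⁻¹G) p , Sg⁻¹p , actG-inverseʳ g p

  image-inverseˡ : ∀ g {S} → Extensional S → image (g ⁻¹G) (image g S) ≋ S
  image-inverseˡ g S-ext p =
    (λ (q , (r , Sr , e) , e′) →
       S-ext (P.trans (P.sym (actG-inverseˡ g r)) (P.trans (actG-cong (g ⁻¹G) e) e′)) Sr) ,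
    (λ Sp → actG g p , (p , Sp , P.refl) , actG-inverseˡ g p)

  image-inverseʳ : ∀ g {S} → Extensional S → image g (image (g ⁻¹G) S) ≋ S
  image-inverseʳ g S-ext p =
    (λ (q , (r , Sr , e) , e′) →
       S-ext (P.trans (P.sym (actG-inverseʳ g r)) (P.trans (actG-cong g e) e′)) Sr) ,
    (λ Sp → actG (g ⁻¹G) p , (p , Sp , P.refl) , actG-inverseʳ g p)

  B-extensional : Extensional B
  B-extensional (x≈y , refl) (inj₁ (j<n , inj₁ x≈0)) = inj₁ (j<n , inj₁ (≈-trans (≈-sym x≈y) x≈0))
  B-extensional (x≈y , refl) (inj₁ (j<n , inj₂ x≈ζ)) = inj₁ (j<n , inj₂ (≈-trans (≈-sym x≈y) x≈ζ))
  B-extensional (x≈y , refl) (inj₂ (n≤j , j<k , x≈0)) = inj₂ (n≤j , j<k , ≈-trans (≈-sym x≈y) x≈0)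

  block-extensional : ∀ {S} → IsBlock S → Extensional S
  block-extensional (g , S≋gB) {p} {q} p≈q Sp = proj₂ (S≋gB q) (image-extensional g B p≈q (proj₁ (S≋gB p) Sp))

  image-block : ∀ g {S} → IsBlock S → IsBlock (image g S)
  image-block g (h , S≋hB) = g ∘G h , ≋.trans (image-cong g S≋hB) (≋.sym (image-∘ g h B))

  block-transitive : BlockTransitive
  block-transitive S T (g , S≋gB) (h , T≋hB) = h ∘G g ⁻¹G ,
    ≋.trans (image-∘ h (g ⁻¹G) S) (≋.trans
      (image-cong h (≋.trans (image-cong (g ⁻¹G) S≋gB) (image-inverseˡ g B-extensional))) (≋.sym T≋hB))

  B? : ∀ p → Dec (B p)
  B? (x , j) = (toℕ j ℕₚ.<? n ×-dec (x ≟ 0# ⊎-dec x ≟ ζ^ toℕ j))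
         ⊎-dec (n ℕₚ.≤? toℕ j ×-dec toℕ j ℕₚ.<? k ∸ n ×-dec x ≟ 0#)

  -- Membership in gB is an existential over points; moving `p` back by g⁻¹ reduces it to membership
  -- in `B`.
  gB? : ∀ g p → Dec (image g B p)
  gB? g p = mapDec (image⁺ g) (image⁻ g B-extensional) (B? (actG (g ⁻¹G) p))

  gB≋? : ∀ g h → Dec (image g B ≋ image h B)
  gB≋? g h = mapDec
    (λ same p → let i , p≈ = complete points p tt in
      image-extensional h B (P.sym p≈) ∘ proj₁ (same i) ∘ image-extensional g B p≈ ,
      image-extensional g B (P.sym p≈) ∘ proj₂ (same i) ∘ image-extensional h B p≈)
    (λ same i → same (elt points i))
    (Finₚ.all? λ i → let p = elt points i in (gB? g p →-dec gB? h p) ×-dec (gB? h p →-dec gB? g p))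

  -- Every block is a translate of `B`, and the finitely many elements of `GCover` give all
  -- translates. `select`, with g and h identified when gB and hB coincide, discards the repetitions
  -- and the translates that fail `Q`.
  enum-blocks : {Q : PSet → Set} → (∀ g → Dec (Q (image g B))) → (∀ {S T} → S ≋ T → Q S → Q T) →
    Σ ℕ λ m → Enum _≋_ (λ S → IsBlock S × Q S) m
  enum-blocks {Q} Q? Q-resp = let _ , e , covers = GCover ; m , E = select gB-isEquivalence gB≋? Q? Q-resp e in
    m , enum-map ≋.trans (λ g → image g B) id (λ _ _ → id)
      (λ g (qg , _) → (g , ≋.refl) , qg)
      (λ S ((g , S≋gB) , qS) → let i , g≈eᵢ = covers g in
        g , (Q-resp S≋gB qS , i , image-cong-act {g} {e i} B g≈eᵢ) , S≋gB) E
    where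
    gB-isEquivalence : IsEquivalence (λ g h → image g B ≋ image h B)
    gB-isEquivalence = record { refl = ≋.refl ; sym = ≋.sym ; trans = ≋.trans }

  -- The design property: double counting over a G-orbit of ordered pairs

  module _ {_≈₂_ : PP → PP → Set} (eq : IsEquivalence _≈₂_)
    (≈₂-cong : ∀ g {p q p′ q′} → (p , q) ≈₂ (p′ , q′) → (actG g p , actG g q) ≈₂ (actG g p′ , actG g q′))
    (pointwise : ∀ {p q p′ q′} → p ≈P p′ → q ≈P q′ → (p , q) ≈₂ (p′ , q′))
    {O : Point → Point → Set} (O-inv : ∀ g {p q} → O p q → O (actG g p) (actG g q)) where

    private module ≈₂ = IsEquivalence eq

    -- If S = gB, the action of g matches the pairs. The equality of pairs stays generic because
    -- double counting needs ordered pairs and the Delandtsheer-Doyen parameters need unordered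
    -- ones.
    pairs-in-block : ∀ {r} → Enum _≈₂_ (λ (p , q) → O p q × B p × B q) r →
      ∀ {S} → IsBlock S → Enum _≈₂_ (λ (p , q) → O p q × S p × S q) r
    pairs-in-block E {S} (g , S≋gB) = enum-map ≈₂.trans (λ (p , q) → actG g p , actG g q)
      (≈₂-cong g)
      (λ _ _ eq′ → ≈₂.trans (≈₂.sym cancel) (≈₂.trans (≈₂-cong (g ⁻¹G) eq′) cancel))
      (λ (p , q) (Opq , Bp , Bq) → O-inv g Opq ,
        proj₂ (S≋gB (actG g p)) (p , Bp , P.refl) , proj₂ (S≋gB (actG g q)) (q , Bq , P.refl))
      (λ (p , q) (Opq , Sp , Sq) → (actG (g ⁻¹G) p , actG (g ⁻¹G) q) ,
        (O-inv (g ⁻¹G) Opq , image⁻ g B-extensional (proj₁ (S≋gB p) Sp) , image⁻ g B-extensional (proj₁ (S≋gB q) Sq)) ,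
        pointwise (P.sym (actG-inverseʳ g p)) (P.sym (actG-inverseʳ g q)))
      E
      where
      cancel : ∀ {p q} → (actG (g ⁻¹G) (actG g p) , actG (g ⁻¹G) (actG g q)) ≈₂ (p , q)
      cancel = pointwise (actG-inverseˡ g _) (actG-inverseˡ g _)

  Through : Point → Point → PSet → Set
  Through p q S = IsBlock S × S p × S q

  -- S ↦ gS is a bijection between the blocks through the two pairs, with inverse given by g⁻¹.
  -- Hence the number of blocks is constant on each orbit of pairs.
  through-image : ∀ {m} g {p q p′ q′} → actG g p ≈P p′ → actG g q ≈P q′ →
    Enum _≋_ (Through p q) m → Enum _≋_ (Through p′ q′) m
  through-image g {p} {q} gp≈ gq≈ = enum-map ≋.trans (image g) (image-cong g)
    (λ (bS , _) (bT , _) eq → ≋.trans (≋.sym (image-inverseˡ g (block-extensional bS)))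
      (≋.trans (image-cong (g ⁻¹G) eq) (image-inverseˡ g (block-extensional bT))))
    (λ S (bS , Sp , Sq) → image-block g bS , (p , Sp , gp≈) , (q , Sq , gq≈))
    (λ T (bT , Tp , Tq) → image (g ⁻¹G) T ,
      (image-block (g ⁻¹G) bT ,
       (_ , Tp , P.trans (actG-cong (g ⁻¹G) (P.sym gp≈)) (actG-inverseˡ g p)) ,
       (_ , Tq , P.trans (actG-cong (g ⁻¹G) (P.sym gq≈)) (actG-inverseˡ g q))) ,
      ≋.sym (image-inverseʳ g (block-extensional bT)))

  blocks : Σ ℕ λ m → Enum _≋_ (λ S → IsBlock S × ⊤) m
  blocks = enum-blocks (λ _ → yes tt) (λ _ → id)

  blockCount : ℕ
  blockCount = proj₁ blocks

  -- `m` is whatever number `enum-blocks` finds at the base pair; `through-image` carries it to the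
  -- rest of the orbit.
  orbit-count : ∀ {O : Point → Point → Set} {N r} →
    (∀ g {p q} → O p q → O (actG g p) (actG g q)) →
    ∀ p₀ q₀ → (∀ {p q} → O p q → Σ GElt λ g → actG g p₀ ≈P p × actG g q₀ ≈P q) →
    Enum _≈PP_ (λ (p , q) → O p q) N → Enum _≈PP_ (λ (p , q) → O p q × B p × B q) r →
    Σ ℕ λ m → (∀ {p q} → O p q → Enum _≋_ (Through p q) m) × blockCount * r ≡ N * m
  orbit-count {O} O-inv p₀ q₀ generates E E′ = m , through ,
    double-count ≋-isEquivalence PP-eq
      (λ S≋T (Sp , Sq) → proj₁ (S≋T _) Sp , proj₁ (S≋T _) Sq)
      (λ (bS , _) (e , f) (Sp , Sq) → block-extensional bS e Sp , block-extensional bS f Sq)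
      (proj₂ blocks)
      (λ S (bS , _) → pairs-in-block PP-eq (λ g (e , f) → actG-cong g e , actG-cong g f) _,_ O-inv E′ bS)
      E
      (λ _ Opq → enum-⇔ (λ _ (bS , pq) → (bS , tt) , pq) (λ _ ((bS , _) , pq) → bS , pq) (through Opq))
    where
    PP-eq : IsEquivalence _≈PP_
    PP-eq = ×-isEquivalence points-isEquivalence points-isEquivalence
    base : Σ ℕ λ m → Enum _≋_ (Through p₀ q₀) m
    base = enum-blocks {λ S → S p₀ × S q₀} (λ g → gB? g p₀ ×-dec gB? g q₀)
      (λ S≋T (Sp , Sq) → proj₁ (S≋T _) Sp , proj₁ (S≋T _) Sq)
    m : ℕ
    m = proj₁ base
    through : ∀ {p q} → O p q → Enum _≋_ (Through p q) m
    through Opq = let g , e , f = generates Opq in through-image g e f (proj₂ base)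

  -- Pairs of points inside B

  -- `B` is regrouped into the zeros over the first k - n classes and the points ζʲ over the first
  -- n. The two parts are disjoint because powers of ζ are nonzero.
  B-size : Enum _≈P_ B k
  B-size = subst (Enum _≈P_ B) (ℕₚ.m∸n+n≡m n≤k) (enum-⇔ to from
    (enum-⊎ P.sym (λ { {_ , j} (_ , x≈0) (_ , y≈ζ) (x≈y , refl) →
        ζ^≉0 (toℕ j) (≈-trans (≈-sym y≈ζ) (≈-trans (≈-sym x≈y) x≈0)) })
      (section (k ∸ n) k∸n≤d (λ _ → 0#))
      (section n (ℕₚ.≤-trans n≤k∸n k∸n≤d) (λ j → ζ^ toℕ j))))
    where
    section : ∀ m → m ≤ d → (f : Fin d → F) → Enum _≈P_ (λ (x , j) → toℕ j < m × x ≈ f j) m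
    section m m≤d f = enum-map P.trans (λ j → f j , j) (λ { refl → P.refl }) (λ _ _ → proj₂)
      (λ _ j<m → j<m , ≈-refl) (λ (x , j) (j<m , x≈) → j , j<m , x≈ , refl) (enum-Fin-< m≤d)
    to : ∀ p → _ → B p
    to (x , j) (inj₁ (j<k , x≈0)) with toℕ j ℕₚ.<? n
    ... | yes j<n = inj₁ (j<n , inj₁ x≈0)
    ... | no j≮n = inj₂ (ℕₚ.≮⇒≥ j≮n , j<k , x≈0)
    to (x , j) (inj₂ (j<n , x≈ζ)) = inj₁ (j<n , inj₂ x≈ζ)
    from : ∀ p → B p → _
    from _ (inj₁ (j<n , inj₁ x≈0)) = inj₁ (ℕₚ.<-≤-trans j<n n≤k∸n , x≈0)
    from _ (inj₁ (j<n , inj₂ x≈ζ)) = inj₂ (j<n , x≈ζ)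
    from _ (inj₂ (_ , j<k , x≈0)) = inj₁ (j<k , x≈0)

  block-size : ∀ S → IsBlock S → Enum _≈P_ S k
  block-size S (g , S≋gB) = enum-⇔ (λ p → proj₂ (S≋gB p)) (λ p → proj₁ (S≋gB p))
    (enum-map P.trans (actG g) (actG-cong g) (λ _ _ → actG-injective g)
      (λ p Bp → p , Bp , P.refl) (λ p (q , Bq , e) → q , Bq , P.sym e) B-size)

  B-inner : ∀ {x y j} → B (x , j) → B (y , j) → ¬ x ≈ y →
    toℕ j < n × ((x ≈ 0# × y ≈ ζ^ toℕ j) ⊎ (x ≈ ζ^ toℕ j × y ≈ 0#))
  B-inner (inj₁ (j<n , inj₁ x≈0)) (inj₁ (_ , inj₂ y≈ζ)) _ = j<n , inj₁ (x≈0 , y≈ζ)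
  B-inner (inj₁ (j<n , inj₂ x≈ζ)) (inj₁ (_ , inj₁ y≈0)) _ = j<n , inj₂ (x≈ζ , y≈0)
  B-inner (inj₁ (_ , inj₁ x≈0)) (inj₁ (_ , inj₁ y≈0)) x≉y = contradiction (≈-trans x≈0 (≈-sym y≈0)) x≉y
  B-inner (inj₁ (_ , inj₂ x≈ζ)) (inj₁ (_ , inj₂ y≈ζ)) x≉y = contradiction (≈-trans x≈ζ (≈-sym y≈ζ)) x≉y
  B-inner (inj₂ (_ , _ , x≈0)) (inj₂ (_ , _ , y≈0)) x≉y = contradiction (≈-trans x≈0 (≈-sym y≈0)) x≉y
  B-inner (inj₁ (j<n , _)) (inj₂ (n≤j , _)) _ = contradiction j<n (ℕₚ.≤⇒≯ n≤j)
  B-inner (inj₂ (n≤j , _)) (inj₁ (j<n , _)) _ = contradiction j<n (ℕₚ.≤⇒≯ n≤j)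

  Inner Outer : Point → Point → Set
  Inner p q = ¬ p ≈P q × SameClass p q
  Outer p q = ¬ p ≈P q × ¬ SameClass p q

  UP-isEquivalence : IsEquivalence _≈UP_
  UP-isEquivalence = unordered-isEquivalence points-isEquivalence

  B-inner-pairs : Enum _≈UP_ (λ (p , q) → Inner p q × B p × B q) n
  B-inner-pairs = enum-map (IsEquivalence.trans UP-isEquivalence) (λ j → (0# , j) , (ζ^ toℕ j , j))
    (λ { refl → IsEquivalence.refl UP-isEquivalence })
    (λ { _ _ (inj₁ (e , _)) → proj₂ e ; _ _ (inj₂ (e , _)) → proj₂ e })
    (λ j j<n → ((λ (0≈ζ , _) → ζ^≉0 (toℕ j) (≈-sym 0≈ζ)) , refl) , inj₁ (j<n , inj₁ ≈-refl) , inj₁ (j<n , inj₂ ≈-refl))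
    (λ { ((x , j) , (y , .j)) ((p≉q , refl) , Bp , Bq) → let j<n , xy = B-inner Bp Bq (λ x≈y → p≉q (x≈y , refl)) in
         j , j<n , [ (λ (x≈ , y≈) → inj₁ ((x≈ , refl) , (y≈ , refl)))
                   , (λ (x≈ , y≈) → inj₂ ((x≈ , refl) , (y≈ , refl))) ]′ xy })
    (enum-Fin-< (ℕₚ.≤-trans n≤k∸n k∸n≤d))

  -- Counted as a complement: filtering all C(k,2) pairs of `B` leaves some number m, and n + m =
  -- C(k,2) = c + n.
  B-outer-pairs : Enum _≈UP_ (λ (p , q) → Outer p q × B p × B q) c
  B-outer-pairs = subst (Enum _≈UP_ _) (ℕₚ.+-cancelʳ-≡ n m c (trans (ℕₚ.+-comm m n) n+m≡c+n)) outer
    where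
    pairs : Enum _≈UP_ (λ (p , q) → B p × B q × ¬ p ≈P q) (k C 2)
    pairs = enum-unordered-pairs points-isEquivalence B-size
    distinct-resp : ∀ {v w} → v ≈UP w → (B (proj₁ v) × B (proj₂ v) × ¬ proj₁ v ≈P proj₂ v) →
      B (proj₁ w) × B (proj₂ w) × ¬ proj₁ w ≈P proj₂ w
    distinct-resp (inj₁ (e , f)) (Bp , Bq , p≉q) = B-extensional e Bp , B-extensional f Bq ,
      λ p≈q → p≉q (P.trans e (P.trans p≈q (P.sym f)))
    distinct-resp (inj₂ (e , f)) (Bp , Bq , p≉q) = B-extensional f Bq , B-extensional e Bp ,
      λ q≈p → p≉q (P.trans e (P.trans (P.sym q≈p) (P.sym f)))
    outer-resp : ∀ {v w} → v ≈UP w → ¬ SameClass (proj₁ v) (proj₂ v) → ¬ SameClass (proj₁ w) (proj₂ w)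
    outer-resp (inj₁ (e , f)) i≢j i≡j = i≢j (trans (proj₂ e) (trans i≡j (sym (proj₂ f))))
    outer-resp (inj₂ (e , f)) i≢j j≡i = i≢j (trans (proj₂ e) (trans (sym j≡i) (sym (proj₂ f))))
    filtered : Σ ℕ λ m →
      Enum _≈UP_ (λ (p , q) → (B p × B q × ¬ p ≈P q) × ¬ SameClass p q) m
    filtered = enum-filter UP-isEquivalence _≟UP_ distinct-resp
      (λ (p , q) → ¬? (proj₂ p Finₚ.≟ proj₂ q)) outer-resp pairs
    m : ℕ
    m = proj₁ filtered
    outer : Enum _≈UP_ (λ (p , q) → Outer p q × B p × B q) m
    outer = enum-⇔ (λ _ ((Bp , Bq , p≉q) , i≢j) → (p≉q , i≢j) , Bp , Bq)
                   (λ _ ((p≉q , i≢j) , Bp , Bq) → (Bp , Bq , p≉q) , i≢j) (proj₂ filtered)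
    n+m≡c+n : n + m ≡ c + n
    n+m≡c+n = trans (enum-unique UP-isEquivalence
        (λ { _ (inj₁ ((p≉q , _) , Bp , Bq)) → Bp , Bq , p≉q ; _ (inj₂ ((p≉q , _) , Bp , Bq)) → Bp , Bq , p≉q })
        (λ (p , q) (Bp , Bq , p≉q) → split p q Bp Bq p≉q)
        (enum-⊎ (IsEquivalence.sym UP-isEquivalence)
          (λ { ((_ , i≡j) , _) ((_ , k≢l) , _) (inj₁ (e , f)) → k≢l (trans (sym (proj₂ e)) (trans i≡j (proj₂ f)))
             ; ((_ , i≡j) , _) ((_ , k≢l) , _) (inj₂ (e , f)) → k≢l (trans (sym (proj₂ f)) (trans (sym i≡j) (proj₂ e))) })
          B-inner-pairs outer)
        pairs)
      (sym c+n≡kC2)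
      where
      split : ∀ p q → B p → B q → ¬ p ≈P q → (Inner p q × B p × B q) ⊎ (Outer p q × B p × B q)
      split p q Bp Bq p≉q with proj₂ p Finₚ.≟ proj₂ q
      ... | yes i≡j = inj₁ ((p≉q , i≡j) , Bp , Bq)
      ... | no i≢j = inj₂ ((p≉q , i≢j) , Bp , Bq)

  -- Invariance of the pair types and the outer orbit

  distinct-invariant : ∀ g {p q} → ¬ p ≈P q → ¬ actG g p ≈P actG g q
  distinct-invariant g p≉q eq = p≉q (actG-injective g eq)

  class-invariant : ∀ g {p q} → ¬ SameClass p q → ¬ SameClass (actG g p) (actG g q)
  class-invariant (hs , σ) i≢j eq = i≢j
    (trans (sym (Perm.inverseˡ σ)) (trans (cong (σ ⟨$⟩ˡ_) eq) (Perm.inverseˡ σ)))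

  UP-cong : ∀ g {p q p′ q′} → (p , q) ≈UP (p′ , q′) → (actG g p , actG g q) ≈UP (actG g p′ , actG g q′)
  UP-cong g (inj₁ (e , f)) = inj₁ (actG-cong g e , actG-cong g f)
  UP-cong g (inj₂ (e , f)) = inj₂ (actG-cong g e , actG-cong g f)

  outer-count : Σ ℕ λ m → (∀ {p q} → ¬ SameClass p q → Enum _≋_ (Through p q) m) ×
    blockCount * (c + c) ≡ c * d * (c * D) * m
  outer-count = orbit-count {λ p q → ¬ SameClass p q} class-invariant (0# , zero) (0# , suc zero) generates
    (enum-⇔ (λ _ (_ , _ , i≢j) → i≢j) (λ _ i≢j → tt , tt , i≢j)
      (enum-Σ {I = λ p q → ⊤ × ¬ SameClass p q} P.sym (λ { (_ , refl) z → z }) points λ (_ , i) _ →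
        enum-Σ {I = λ _ j → i ≢ j} ≈-sym (λ _ z → z) elements λ _ _ → others i))
    (enum-⇔ (λ _ ((_ , i≢j) , z) → i≢j , z) (λ _ (i≢j , z) → ((λ (_ , i≡j) → i≢j i≡j) , i≢j) , z)
      (enum-ordered points-isEquivalence
        (λ { e@(_ , refl) f@(_ , refl) ((p≉q , i≢j) , Bp , Bq) →
             ((λ p≈q → p≉q (P.trans e (P.trans p≈q (P.sym f)))) , i≢j) , B-extensional e Bp , B-extensional f Bq })
        (λ ((p≉q , i≢j) , Bp , Bq) → (p≉q ∘ P.sym , i≢j ∘ sym) , Bq , Bp)
        (λ ((p≉q , _) , _) → p≉q)
        B-outer-pairs))
    where
    others : ∀ i → Enum _≡_ (λ (j : Fin d) → i ≢ j) D
    others i = record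
      { elt = Fin.punchIn i
      ; injective = Finₚ.punchIn-injective i _ _
      ; sound = λ j i≡ → Finₚ.punchInᵢ≢i i j (sym i≡)
      ; complete = λ j i≢j → Fin.punchOut i≢j , sym (Finₚ.punchIn-punchOut i≢j)
      }
    generates : ∀ {p q} → ¬ SameClass p q →
      Σ GElt λ g → actG g (0# , zero) ≈P p × actG g (0# , suc zero) ≈P q
    generates {x , i} {y , j} i≢j = let σ , e , f = two-transitive {i = zero} {suc zero} (λ ()) i≢j in
      -- The base group acts independently on the classes: class `zero` is translated by x and every
      -- other class by y, then σ places the two classes.
      ((λ { zero → 0 , x ; (suc _) → 0 , y }) , σ) , (actH-0 0 x , e) , (actH-0 0 y , f)

  -- The inner orbits, one for each coset of ⟨ζⁿ⟩

  InnerOf : ℕ → Point → Point → Set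
  InnerOf i (x , j) (y , l) = j ≡ l × Σ ℕ λ t → y ≈ ζ^ (n * t) *F ζ^ i +F x

  inner-distinct : ∀ i {p q} → InnerOf i p q → ¬ p ≈P q
  inner-distinct i {x , _} {y , _} (_ , t , y≈) (x≈y , _) = *-nonzero (ζ^≉0 (n * t)) (ζ^≉0 i)
    (+-cancelʳ x _ _ (≈-trans (≈-sym y≈) (≈-trans (≈-sym x≈y) (≈-sym (+-identityˡ x)))))

  -- The reversed difference is -ζ^(nt)ζⁱ, and -1 = ζ^(ns) turns the exponent t into s + t. Thus
  -- both orderings of a pair lie in the same orbit.
  inner-sym : ∀ i {p q} → InnerOf i p q → InnerOf i q p
  inner-sym i {x , _} {y , _} (j≡l , t , y≈) = sym j≡l , s + t , (begin
    x                                            ≈⟨ +-identityˡ x ⟨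
    0# +F x                                      ≈⟨ +-congʳ (-‿inverseˡ z) ⟨
    - z +F z +F x                                ≈⟨ +-assoc _ _ _ ⟩
    - z +F (z +F x)                              ≈⟨ +-cong (negate-coset t i) y≈ ⟨
    ζ^ (n * (s + t)) *F ζ^ i +F y                ∎)
    where
    open SetoidReasoning setoid
    z : F
    z = ζ^ (n * t) *F ζ^ i

  inner-resp : ∀ i {p q p′ q′} → p ≈P p′ → q ≈P q′ → InnerOf i p q → InnerOf i p′ q′
  inner-resp i (x≈ , refl) (y≈ , refl) (j≡l , t , y≈zx) =
    j≡l , t , ≈-trans (≈-sym y≈) (≈-trans y≈zx (+-congˡ x≈))

  inner-invariant : ∀ i g {p q} → InnerOf i p q → InnerOf i (actG g p) (actG g q)
  inner-invariant i (hs , σ) {x , j} {y , _} (refl , t , y≈) = refl , proj₁ (hs j) + t , (begin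
    actH (hs j) y                                              ≈⟨ actH-cong (hs j) y≈ ⟩
    u *F (ζ^ (n * t) *F ζ^ i +F x) +F b′                       ≈⟨ +-congʳ (distribˡ _ _ _) ⟩
    u *F (ζ^ (n * t) *F ζ^ i) +F u *F x +F b′                  ≈⟨ +-assoc _ _ _ ⟩
    u *F (ζ^ (n * t) *F ζ^ i) +F (u *F x +F b′)                ≈⟨ +-congʳ (≈-trans (*-congʳ (ζ^n-+ _ t)) (*-assoc _ _ _)) ⟨
    ζ^ (n * (proj₁ (hs j) + t)) *F ζ^ i +F (u *F x +F b′)      ∎)
    where
    open SetoidReasoning setoid
    u b′ : F
    u = ζ^ (n * proj₁ (hs j))
    b′ = proj₂ (hs j)

  -- `j₀` has two roles: the exponent that names the coset, and the class in which `B` has its only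
  -- pair with difference in that coset. The 2 counts the orderings of this pair; D counts the
  -- second points, one for each element of ⟨ζⁿ⟩.
  inner-count : ∀ j₀ → toℕ j₀ < n → Σ ℕ λ m → (∀ {p q} → InnerOf (toℕ j₀) p q → Enum _≋_ (Through p q) m) ×
    blockCount * 2 ≡ c * d * D * m
  inner-count j₀ j₀<n = orbit-count {InnerOf i} (inner-invariant i) p₀ q₀ generates
    (enum-⇔ (λ _ → proj₂) (λ _ → tt ,_)
      (enum-Σ {I = InnerOf i} P.sym (λ {_} {_} {q} e → inner-resp i e (P.refl {q})) points λ (x , j) _ →
        enum-map P.trans (λ t → ζ^ (n * t) *F ζ^ i +F x , j)
          (λ e → +-congʳ (*-congʳ e) , refl)
          (λ {t} {t′} _ _ (e , _) → *-cancelˡ (ζ^≉0 i) (≈-trans (*-comm _ _) (≈-trans (+-cancelʳ x _ _ e) (*-comm _ _))))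
          (λ t _ → refl , t , ≈-refl)
          (λ (y , l) (j≡l , t , y≈) → t , tt , y≈ , sym j≡l)
          exponents))
    (enum-ordered points-isEquivalence
      (λ e f (Opq , Bp , Bq) → inner-resp i e f Opq , B-extensional e Bp , B-extensional f Bq)
      (λ (Opq , Bp , Bq) → inner-sym i Opq , Bq , Bp)
      (λ (Opq , _) → inner-distinct i Opq)
      (enum-singleton (p₀ , q₀)
        (base , inj₁ (j₀<n , inj₁ ≈-refl) , inj₁ (j₀<n , inj₂ ≈-refl))
        unique))
    where
    i : ℕ
    i = toℕ j₀
    p₀ q₀ : Point
    p₀ = 0# , j₀
    q₀ = ζ^ i , j₀
    ζ^n0≈1 : ζ^ (n * 0) ≈ 1#
    ζ^n0≈1 = ζ^-cong (ℕₚ.*-zeroʳ n)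
    base : InnerOf i p₀ q₀
    base = refl , 0 , ≈-sym (≈-trans (+-identityʳ _) (≈-trans (*-congʳ ζ^n0≈1) (*-identityˡ _)))
    generates : ∀ {p q} → InnerOf i p q → Σ GElt λ g → actG g p₀ ≈P p × actG g q₀ ≈P q
    generates {x , j} (refl , t , y≈) = ((λ _ → t , x) , transpose j₀ j) ,
      (actH-0 t x , transpose-sends j₀ j) , (≈-sym y≈ , transpose-sends j₀ j)
    index-unique : ∀ {x y j} → toℕ j < n → InnerOf i (x , j) (y , j) → x ≈ 0# → y ≈ ζ^ toℕ j → j ≡ j₀
    index-unique {x} {y} {j} j<n (_ , t , y≈) x≈0 y≈ζ = Finₚ.toℕ-injective (coset-unique {0} {t} j<n j₀<n (begin
      ζ^ (n * 0) *F ζ^ toℕ j        ≈⟨ ≈-trans (*-congʳ ζ^n0≈1) (*-identityˡ _) ⟩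
      ζ^ toℕ j                      ≈⟨ y≈ζ ⟨
      y                             ≈⟨ y≈ ⟩
      ζ^ (n * t) *F ζ^ i +F x       ≈⟨ +-congˡ x≈0 ⟩
      ζ^ (n * t) *F ζ^ i +F 0#      ≈⟨ +-identityʳ _ ⟩
      ζ^ (n * t) *F ζ^ i            ∎))
      where open SetoidReasoning setoid
    unique : ∀ w → (InnerOf i (proj₁ w) (proj₂ w) × B (proj₁ w) × B (proj₂ w)) → w ≈UP (p₀ , q₀)
    unique ((x , j) , (y , _)) (I@(refl , _) , Bp , Bq) =
      let j<n , ends = B-inner Bp Bq (λ x≈y → inner-distinct i I (x≈y , refl)) in
      [ (λ (x≈0 , y≈ζ) → inj₁ (at (index-unique j<n I x≈0 y≈ζ) x≈0 y≈ζ))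
      -- `inner-sym` brings the reversed pair to the first case.
      , (λ (x≈ζ , y≈0) → inj₂ (swap (at (index-unique j<n (inner-sym i {x , j} {y , j} I) y≈0 x≈ζ) y≈0 x≈ζ))) ]′ ends
      where
      at : ∀ {x y j} → j ≡ j₀ → x ≈ 0# → y ≈ ζ^ toℕ j → (x , j) ≈P p₀ × (y , j) ≈P q₀
      at refl x≈0 y≈ζ = (x≈0 , refl) , (y≈ζ , refl)

  -- Equality of the pair degrees and the conclusion

  pairDegree : ℕ
  pairDegree = proj₁ outer-count

  -- Multiplied by c, the inner equation becomes the outer one with `m` in place of `pairDegree`.
  -- The common factor cd · cD is positive and cancels.
  inner≡outer : ∀ {m} → blockCount * 2 ≡ c * d * D * m → m ≡ pairDegree
  inner≡outer {m} eq = ℕₚ.*-cancelˡ-≡ m pairDegree (c * d * (c * D)) (begin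
    c * d * (c * D) * m       ≡⟨ solve 4 (λ c d D m → c :* d :* (c :* D) :* m := c :* (c :* d :* D :* m)) refl c d D m ⟩
    c * (c * d * D * m)       ≡⟨ cong (c *_) eq ⟨
    c * (blockCount * 2)               ≡⟨ solve 2 (λ c b → c :* (b :* con 2) := b :* (c :+ c)) refl c blockCount ⟩
    blockCount * (c + c)               ≡⟨ proj₂ (proj₂ outer-count) ⟩
    c * d * (c * D) * pairDegree   ∎)
    where
    open ≡-Reasoning
    open +-*-Solver

  balanced : ∀ p q → ¬ p ≈P q → Enum _≋_ (Through p q) pairDegree
  balanced (x , j) (y , j′) p≉q = by-class (j Finₚ.≟ j′)
    where
    by-class : Dec (j ≡ j′) → Enum _≋_ (Through (x , j) (y , j′)) pairDegree
    by-class (no j≢j′) = proj₁ (proj₂ outer-count) j≢j′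
    by-class (yes j≡j′) =
      let i , i<n , t , y≈ = difference-coset (λ x≈y → p≉q (x≈y , j≡j′))
          -- Since n ≤ d, the coset exponent i is also the index of a class.
          i<d = ℕₚ.<-≤-trans i<n (ℕₚ.≤-trans n≤k∸n k∸n≤d)
          toℕ≡i = Finₚ.toℕ-fromℕ< i<d
          _ , through , equation = inner-count (Fin.fromℕ< i<d) (subst (_< n) (sym toℕ≡i) i<n)
      in subst (Enum _≋_ _) (inner≡outer equation)
           (through (j≡j′ , t , subst (λ i → y ≈ ζ^ (n * t) *F ζ^ i +F x) (sym toℕ≡i) y≈))

  partition-invariant : PartitionInvariant
  partition-invariant g@(hs , σ) j = σ ⟨$⟩ʳ j , λ (x , l) →
    (λ { ((y , _) , refl , _ , e) → sym e }) ,
    (λ { refl → actG (g ⁻¹G) (x , l) , Perm.inverseˡ σ , actG-inverseʳ g (x , l) })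

  ddParams : DDParams 1 n
  ddParams = s≤s z≤n , ℕₚ.≤-trans (s≤s z≤n) 2≤n ,
    trans (ℕₚ.*-identityˡ c) (sym (trans (cong (_∸ n) (sym c+n≡kC2)) (ℕₚ.m+n∸n≡m c n))) ,
    -- With c = nD + 1, the number c + n - 1 computes to nD + n = nd.
    trans (trans (ℕₚ.*-suc n D) (ℕₚ.+-comm n (n * D))) (cong (_∸ 1) c+n≡kC2) ,
    λ S bS →
      enum⇒size (enum-⇔ (λ _ ((p≉q , same) , Sp , Sq) → Sp , Sq , p≉q , same)
                        (λ _ (Sp , Sq , p≉q , same) → (p≉q , same) , Sp , Sq)
        (pairs-in-block UP-isEquivalence UP-cong (λ e f → inj₁ (e , f))
          (λ g (p≉q , same) → distinct-invariant g p≉q , cong (proj₂ g ⟨$⟩ʳ_) same) B-inner-pairs bS)) ,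
      subst (HasSize _≈UP_ _) (sym (ℕₚ.*-identityˡ c))
        (enum⇒size (enum-⇔ (λ _ ((p≉q , same) , Sp , Sq) → Sp , Sq , p≉q , same)
                           (λ _ (Sp , Sq , p≉q , same) → (p≉q , same) , Sp , Sq)
          (pairs-in-block UP-isEquivalence UP-cong (λ e f → inj₁ (e , f))
            (λ g {p} {q} (p≉q , other) → distinct-invariant g p≉q , class-invariant g {p} {q} other) B-outer-pairs bS)))

  conclusion : Conclusion R ζ n c d k
  conclusion =
    (enum⇒size points , (λ S bS → enum⇒size (block-size S bS)) , pairDegree , λ p q p≉q → enum⇒size (balanced p q p≉q)) ,
    ((λ g p → actG (g ⁻¹G) p , actG-inverseʳ g p) , (λ g p q → actG-injective g) , (λ g S → image-block g)) ,
    block-transitive ,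
    (point-transitive , partition-invariant , s≤s (ℕₚ.≤-trans (s≤s z≤n) 2≤nD) , s≤s (s≤s z≤n)) ,
    ddParams ,
    (subst RankH (ℕₚ.+-comm 1 n) (enum⇒size rankH) , enum⇒size pairRankH) ,
    (enum⇒size rankK , enum⇒size pairRankK)

-- Reduction to the parameters s and D

theorem5p5 : (n p a c d k : ℕ) → 2 ≤ n → Prime p → ¬ (2 ∣ p) → 1 ≤ a → c ≡ p ^ a →
    2 * n ∣ c ∸ 1 → c + n ≡ k C 2 → 2 * n ≤ k → n * d ≡ n + (c ∸ 1) →
    (R : CommutativeRing 0ℓ 0ℓ) → IsField R → HasOrder R c →
    (ζ : CommutativeRing.Carrier R) → IsPrimitive R ζ →
    Conclusion R ζ n c d k
theorem5p5 n p a c d k 2≤n p-prime _ 1≤a c≡pᵃ 2n∣c-1 c+n≡kC2 2n≤k nd≡n+c-1 R isField order ζ prim =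
  from-quotient 2n∣c-1
  where
  1<p : 1 < p
  1<p = nonTrivial⇒n>1 p {{prime⇒nonTrivial p-prime}}
  1<c : 1 < c
  1<c = ℕₚ.≤-trans 1<p (subst (p ≤_) (sym c≡pᵃ) (subst (_≤ p ^ a) (ℕₚ.^-identityʳ p)
    (ℕₚ.^-monoʳ-≤ p {{>-nonZero (ℕₚ.<⇒≤ 1<p)}} 1≤a)))
  -- `c` and `d` are generalised so that both equations can be matched with `refl`. D = 2(s + 1) is
  -- written `suc (s + suc s)`, which makes the halving equation for `suc s` hold by computation.
  rewritten : ∀ s {c d} → c ≡ suc (n * suc (s + suc s)) → d ≡ suc (suc (s + suc s)) →
    c + n ≡ k C 2 → HasOrder R c → Conclusion R ζ n c d k
  rewritten s refl refl c+n≡kC2 order =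
    Design.conclusion R isField ζ prim n (s + suc s) k (suc s) order 2≤n refl c+n≡kC2 2n≤k
  from-quotient : 2 * n ∣ c ∸ 1 → Conclusion R ζ n c d k
  -- A zero quotient would give c ≤ 1, which c = pᵃ with a ≥ 1 excludes.
  from-quotient (divides zero c-1≡0) = contradiction (ℕₚ.m∸n≡0⇒m≤n c-1≡0) (ℕₚ.<⇒≱ 1<c)
  from-quotient (divides (suc s) c-1≡) = rewritten s
    (trans (sym (ℕₚ.m+[n∸m]≡n (ℕₚ.<⇒≤ 1<c))) (cong suc c-1≡nD))
    (ℕₚ.*-cancelˡ-≡ d (suc D) n {{>-nonZero (ℕₚ.<⇒≤ 2≤n)}}
      (trans nd≡n+c-1 (trans (cong (n +_) c-1≡nD) (sym (ℕₚ.*-suc n D)))))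
    c+n≡kC2 order
    where
    D : ℕ
    D = suc (s + suc s)
    c-1≡nD : c ∸ 1 ≡ n * D
    c-1≡nD = trans c-1≡ (solve 2 (λ s n → (con 1 :+ s) :* (con 2 :* n) := n :* (con 1 :+ (s :+ (con 1 :+ s)))) refl s n)
      where open +-*-Solver
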